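{- For every integer $k\ge 2$ there are positive constants $c_k,C_k,C_k'$ depending only on $k$ such that $P_k(n,\epsilon,3)\ge c_k\epsilon^{ -k}$ whenever $C_k' n^{ -1/2}\le \epsilon\le C_k$.
   Context: A hypergraph is $k$-uniform if each edge has exactly $k$ vertices. A (tight) path of length $\ell$ in a $k$-uniform hypergraph consists of $\ell+k-1$ vertices $v_1,\dots,v_{\ell+k-1}$ and the $\ell$ edges $\{v_i,\dots,v_{i+k-1}\}$, $1\le i\le \ell$, all of which are edges; its endpoints are $v_1,v_{\ell+k-1}$. The distance between two vertices is the length of a shortest tight path with those endpoints ($\infty$ if none), and the diameter is the maximum distance between two vertices. The diameter of an edge set $E'$ is that of the hypergraph with edge set $E'$ on the vertices covered by $E'$. $P_k(n,\epsilon,d)$ is the smallest $\ell$ such that every $k$-uniform hypergraph $G=(V,E)$ on $n$ vertices has an edge partition $E=E_0\cup E_1\cup\cdots\cup E_\ell$ with $|E_0|\le\epsilon n^k$ and each $E_i$ ($1\le i\le\ell$) of diameter at most $d$.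
   Formalization: The parameter ε ranges over positive rational numbers instead of reals; since P_k(n,ε,3) is non-increasing in ε, the real case follows by rational approximation from above. -}

module Defs where

open import Data.Nat using (ℕ; zero; suc; _+_; _∸_; _<_; _^_)
open import Data.Fin using (Fin; zero)
open import Data.Fin.Properties using () renaming (_≟_ to _≟ᶠ_)
open import Data.Fin.Subset using (Subset; _∈_; ∣_∣)
open import Data.List using (List; length; filter)
open import Data.List.Relation.Unary.All using (All)
open import Data.List.Relation.Unary.Unique.Propositional using (Unique)
open import Data.List.Membership.Propositional using () renaming (_∈_ to _∈ₗ_)
open import Data.Product using (Σ; ∃; ∃-syntax; _×_)
open import Data.Integer using (+_)
open import Data.Rational using (ℚ; _/_; _*_; _≤_; 1ℚ)
open import Relation.Binary.PropositionalEquality using (_≡_; _≢_)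
open import Function.Bundles using (_⇔_)

ℕtoℚ : ℕ → ℚ
ℕtoℚ n = (+ n) / 1

_^ℚ_ : ℚ → ℕ → ℚ
q ^ℚ zero  = 1ℚ
q ^ℚ suc m = q * (q ^ℚ m)

record Hypergraph (k n : ℕ) : Set where
  field
    edges   : List (Subset n)
    unique  : Unique edges
    uniform : All (λ e → ∣ e ∣ ≡ k) edges
open Hypergraph public

-- An edge colouring  col : Subset n → Fin (suc ℓ)  encodes the partition
-- E = E₀ ∪ E₁ ∪ … ∪ E_ℓ, where E_i = { e ∈ E | col e ≡ i }.
InPart : ∀ {k n ℓ} → Hypergraph k n → (Subset n → Fin (suc ℓ)) → Fin (suc ℓ) → Subset n → Set
InPart G col i e = (e ∈ₗ edges G) × (col e ≡ i)

sizeE₀ : ∀ {k n ℓ} → Hypergraph k n → (Subset n → Fin (suc ℓ)) → ℕ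
sizeE₀ G col = length (filter (λ e → col e ≟ᶠ zero) (edges G))

Covered : ∀ {n} → (Subset n → Set) → Fin n → Set
Covered P x = ∃[ e ] (P e × x ∈ e)

-- A tight path of length ℓ in the k-uniform edge set P, from u to w:
-- vertices v 0, …, v (ℓ + k - 2) (i.e. ℓ + k - 1 of them, 0-indexed),
-- pairwise distinct, such that for each i < ℓ the set
-- { v (i + j) | j < k } is an edge of P; endpoints v 0 = u and v (ℓ+k-2) = w.
TightPath : ∀ {n} (k : ℕ) → (Subset n → Set) → ℕ → Fin n → Fin n → Set
TightPath {n} k P ℓ u w =
  Σ (ℕ → Fin n) λ v →
      (∀ i j → i < ℓ + k ∸ 1 → j < ℓ + k ∸ 1 → v i ≡ v j → i ≡ j)
    × (∀ i → i < ℓ → ∃[ e ] (P e × (∀ x → (x ∈ e) ⇔ (∃[ j ] (j < k × v (i + j) ≡ x)))))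
    × (v 0 ≡ u)
    × (v (ℓ + k ∸ 1 ∸ 1) ≡ w)

DiamAtMost : ∀ {n} (k : ℕ) → (Subset n → Set) → ℕ → Set
DiamAtMost {n} k P d =
  ∀ (u w : Fin n) → Covered P u → Covered P w → u ≢ w →
    ∃[ ℓ ] (1 Data.Nat.≤ ℓ × ℓ Data.Nat.≤ d × TightPath k P ℓ u w)

GoodPartition : ∀ {k n} → Hypergraph k n → ℚ → ℕ → ℕ → Set
GoodPartition {k} {n} G ε d ℓ =
  Σ (Subset n → Fin (suc ℓ)) λ col →
      (ℕtoℚ (sizeE₀ G col) ≤ ε * ℕtoℚ (n ^ k))
    × (∀ (i : Fin ℓ) → DiamAtMost k (InPart G col (Data.Fin.suc i)) d)

-- ℓ is admissible in the definition of P_k(n, ε, d): every k-uniform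
-- hypergraph on n vertices has such a partition into ℓ parts (plus E₀).
Admissible : ℕ → ℕ → ℚ → ℕ → ℕ → Set
Admissible k n ε d ℓ = ∀ (G : Hypergraph k n) → GoodPartition G ε d ℓ

module Submission where

-- Over a prime field F_p with p of order 1/ε take k parts with vertices (X , Y), each
-- blown up, and as edges the transversals with Y₀ + Y₁ + … = X₀ X₁.  In a set of edges
-- of diameter at most 3 two vertices of the same part lie on edges that differ only
-- in that vertex.  Hence Y is constant on the parts j ≥ 2, and the vertices met in
-- the parts 0 and 1 are points and non-vertical lines of the affine plane over F_p
-- such that two points are joined by a line and two lines meet in a point.  As F_p
-- has no proper subfield, such a configuration cannot contain a proper projective
-- subplane, so it is degenerate and has at most 4p incidences.  One colour class
-- therefore covers only a fraction of order p^(-k) of all edges.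

-- Degeneracy. Three lines through a point F, two further points on one of them and one further
-- point on another already generate a translation U ↦ U + K with K ≠ 0 of the reciprocal offsets
-- from F. Over F_p its orbit is the whole field and contains 0, which is no reciprocal. So the
-- absence of subfields enters through the additive group, and what gets excluded is a small pattern
-- of incidences, weak enough to give a bound linear in p. The exponent k. In one class every Y is
-- determined by the X, which saves p^(k-1) because one of the k values Y was already bound by the
-- equation of the edges; and (X₀ , X₁) takes at most 4p instead of p² values, which saves p/4. The
-- product is p^k / 4. Sizes. Before the blow-up a part has p² vertices, so with p of order 1/ε the
-- bound ε ≥ C′ n^(-1/2) makes room for the construction. There are W^k / p edges, where W is the
-- size of a part; p is taken as a small enough multiple of 1/ε that E₀ holds at most half of them.
-- This calls for a prime in every interval of bounded ratio, obtained from a lower bound for common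
-- multiples of 1 , ... , n.

open import Data.Product
open import Data.Sum using (_⊎_; inj₁; inj₂; [_,_]′)
open import Data.Empty using (⊥; ⊥-elim)
open import Relation.Nullary
open import Relation.Binary.PropositionalEquality

-- Primes between 4^b and 16 · 4^b

module PrimeGap where

  open import Data.Nat
  open import Data.Nat.Properties
  open import Data.Nat.Divisibility
  open import Data.Nat.Primality using (Prime; prime?; euclidsLemma; prime⇒irreducible; prime⇒nonTrivial; ¬prime[1])
  open import Data.Nat.Primality.Factorisation using (factorise)
  open import Data.Nat.Coprimality using (Coprime; coprime-divisor)
  open import Data.Nat.Combinatorics using (_C_; nCk+nC[k+1]≡[n+1]C[k+1]; k>n⇒nCk≡0; nCk≡n!/k![n-k]!; k![n∸k]!∣n!)
  open import Data.Nat.DivMod using (m/n*n≡m)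
  open import Data.Nat.ListAction using (product)
  open import Data.Nat.Tactic.RingSolver using (solve-∀)
  open import Data.List using (List; []; _∷_)
  open import Data.List.Relation.Unary.All as All using (All; []; _∷_)

  C-absorb : ∀ n k → suc k * (suc n C suc k) ≡ suc n * (n C k)
  C-absorb zero zero = refl
  C-absorb zero (suc k) = *-zeroʳ (suc (suc k))
  C-absorb (suc n) zero = begin
    1 * (suc (suc n) C 1)            ≡⟨ *-identityˡ _ ⟩
    suc (suc n) C 1                  ≡⟨ nCk+nC[k+1]≡[n+1]C[k+1] (suc n) 0 ⟨
    1 + suc n C 1                    ≡⟨ cong (1 +_) (*-identityˡ _) ⟨
    1 + 1 * (suc n C 1)              ≡⟨ cong (1 +_) (C-absorb n 0) ⟩
    1 + suc n * 1                    ≡⟨⟩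
    suc (suc n) * (suc n C 0)        ∎
    where open ≡-Reasoning
  C-absorb (suc n) (suc k) = begin
    suc (suc k) * (suc (suc n) C suc (suc k))  ≡⟨ cong (suc (suc k) *_) (nCk+nC[k+1]≡[n+1]C[k+1] (suc n) (suc k)) ⟨
    suc (suc k) * (x + y)                      ≡⟨ alg₁ k x y ⟩
    x + (suc k * x + suc (suc k) * y)          ≡⟨ cong₂ (λ u v → x + (u + v)) (C-absorb n k) (C-absorb n (suc k)) ⟩
    x + (suc n * (n C k) + suc n * (n C suc k)) ≡⟨ cong (x +_) (*-distribˡ-+ (suc n) (n C k) (n C suc k)) ⟨
    x + suc n * (n C k + n C suc k)            ≡⟨ cong (λ z → x + suc n * z) (nCk+nC[k+1]≡[n+1]C[k+1] n k) ⟩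
    suc (suc n) * x                            ∎
    where
    open ≡-Reasoning
    x = suc n C suc k
    y = suc n C suc (suc k)
    alg₁ : ∀ k x y → suc (suc k) * (x + y) ≡ x + (suc k * x + suc (suc k) * y)
    alg₁ = solve-∀

  -- The identity (n + 1 - k) C(n + 1 , k) = (n + 1) C(n , k), with the subtraction moved across so
  -- that it makes sense in ℕ for every k.
  C-absorb′ : ∀ n k → suc n * (suc n C k) ≡ k * (suc n C k) + suc n * (n C k)
  C-absorb′ n zero = refl
  C-absorb′ n (suc k) = begin
    suc n * (suc n C suc k)                    ≡⟨ cong (suc n *_) (nCk+nC[k+1]≡[n+1]C[k+1] n k) ⟨
    suc n * (n C k + n C suc k)                ≡⟨ *-distribˡ-+ (suc n) (n C k) (n C suc k) ⟩
    suc n * (n C k) + suc n * (n C suc k)      ≡⟨ cong (_+ suc n * (n C suc k)) (C-absorb n k) ⟨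
    suc k * (suc n C suc k) + suc n * (n C suc k) ∎
    where open ≡-Reasoning

  C≤2^ : ∀ n k → n C k ≤ 2 ^ n
  C≤2^ zero zero = ≤-refl
  C≤2^ zero (suc k) = z≤n
  C≤2^ (suc n) zero = m^n>0 2 (suc n)
  C≤2^ (suc n) (suc k) = begin
    suc n C suc k       ≡⟨ nCk+nC[k+1]≡[n+1]C[k+1] n k ⟨
    n C k + n C suc k   ≤⟨ +-mono-≤ (C≤2^ n k) (C≤2^ n (suc k)) ⟩
    2 ^ n + 2 ^ n       ≡⟨ cong (2 ^ n +_) (+-identityʳ _) ⟨
    2 ^ suc n           ∎
    where open ≤-Reasoning

  rowSum : ℕ → ℕ → ℕ
  rowSum n zero = 0
  rowSum n (suc k) = rowSum n k + n C k

  rowSum-pascal : ∀ n k → rowSum (suc n) (suc k) ≡ rowSum n (suc k) + rowSum n k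
  rowSum-pascal n zero = refl
  rowSum-pascal n (suc k) = begin
    rowSum (suc n) (suc k) + suc n C suc k               ≡⟨ cong₂ _+_ (rowSum-pascal n k) (sym (nCk+nC[k+1]≡[n+1]C[k+1] n k)) ⟩
    (rowSum n (suc k) + rowSum n k) + (n C k + n C suc k) ≡⟨ alg (rowSum n (suc k)) (rowSum n k) (n C k) (n C suc k) ⟩
    (rowSum n (suc k) + n C suc k) + (rowSum n k + n C k) ∎
    where
    open ≡-Reasoning
    alg : ∀ a b c d → (a + b) + (c + d) ≡ (a + d) + (b + c)
    alg = solve-∀

  rowSum-total : ∀ n → rowSum n (suc n) ≡ 2 ^ n
  rowSum-total zero = refl
  rowSum-total (suc n) = begin
    rowSum (suc n) (suc (suc n))                  ≡⟨ rowSum-pascal n (suc n) ⟩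
    rowSum n (suc n) + n C suc n + rowSum n (suc n) ≡⟨ cong₂ (λ u v → u + v + u) (rowSum-total n) (k>n⇒nCk≡0 (n<1+n n)) ⟩
    2 ^ n + 0 + 2 ^ n                             ≡⟨ alg (2 ^ n) ⟩
    2 ^ suc n                                     ∎
    where
    open ≡-Reasoning
    alg : ∀ a → a + 0 + a ≡ 2 * a
    alg = solve-∀

  -- The entries 1 / ((n + 1) · C(n , k)) of Leibniz's harmonic triangle are
  -- integer combinations of 1 , 1/2 , … , 1/(n + 1).
  leibniz-∣ : ∀ {D} n k → k ≤ n → (∀ j → 1 ≤ j → j ≤ suc n → j ∣ D) → suc n * (n C k) ∣ D
  leibniz-∣ {D} n zero _ all = subst (_∣ D) (sym (*-identityʳ (suc n))) (all (suc n) (s≤s z≤n) ≤-refl)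
  leibniz-∣ {D} (suc n) (suc k) (s≤s k≤n) all
    with leibniz-∣ n k k≤n (λ j 1≤j j≤ → all j 1≤j (m≤n⇒m≤1+n j≤))
       | leibniz-∣ (suc n) k (m≤n⇒m≤1+n k≤n) all
  -- The Pascal rule of the harmonic triangle reads 1/c = 1/a - 1/b, so D/c is the difference of the
  -- quotients u and v. It is checked after multiplication by k + 1, where absorption removes the
  -- fractions.
  ... | divides u D≡ua | divides v D≡vb = divides (u ∸ v) (*-cancelˡ-≡ D ((u ∸ v) * c) (suc k) eq)
    where
    open ≡-Reasoning
    a = suc n * (n C k)
    b = suc (suc n) * (suc n C k)
    c = suc (suc n) * (suc n C suc k)
    N = suc n
    na : suc N * a ≡ suc k * c
    na = begin
      suc N * a  ≡⟨ cong (suc N *_) (C-absorb n k) ⟨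
      suc N * (suc k * (suc n C suc k)) ≡⟨ alg (suc N) (suc k) (suc n C suc k) ⟩
      suc k * c ∎
      where
      alg : ∀ x y z → x * (y * z) ≡ y * (x * z)
      alg = solve-∀
    nb : N * b ≡ k * b + suc k * c
    nb = begin
      N * (suc N * (N C k)) ≡⟨ alg N (suc N) (N C k) ⟩
      suc N * (N * (N C k)) ≡⟨ cong (suc N *_) (C-absorb′ n k) ⟩
      suc N * (k * (N C k) + a) ≡⟨ alg₂ (suc N) k (N C k) a ⟩
      k * b + suc N * a ≡⟨ cong (k * b +_) na ⟩
      k * b + suc k * c ∎
      where
      alg : ∀ x y z → x * (y * z) ≡ y * (x * z)
      alg = solve-∀
      alg₂ : ∀ x y z w → x * (y * z + w) ≡ y * (x * z) + x * w
      alg₂ = solve-∀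
    eqU : suc N * D ≡ suc k * (u * c)
    eqU = begin
      suc N * D ≡⟨ cong (suc N *_) D≡ua ⟩
      suc N * (u * a) ≡⟨ alg (suc N) u a ⟩
      u * (suc N * a) ≡⟨ cong (u *_) na ⟩
      u * (suc k * c) ≡⟨ alg u (suc k) c ⟩
      suc k * (u * c) ∎
      where
      alg : ∀ x y z → x * (y * z) ≡ y * (x * z)
      alg = solve-∀
    eqV : N * D ≡ k * D + suc k * (v * c)
    eqV = begin
      N * D ≡⟨ cong (N *_) D≡vb ⟩
      N * (v * b) ≡⟨ alg N v b ⟩
      v * (N * b) ≡⟨ cong (v *_) nb ⟩
      v * (k * b + suc k * c) ≡⟨ alg₂ v k b (suc k) c ⟩
      k * (v * b) + suc k * (v * c) ≡⟨ cong (λ z → k * z + suc k * (v * c)) D≡vb ⟨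
      k * D + suc k * (v * c) ∎
      where
      alg : ∀ x y z → x * (y * z) ≡ y * (x * z)
      alg = solve-∀
      alg₂ : ∀ x y z w t → x * (y * z + w * t) ≡ y * (x * z) + w * (x * t)
      alg₂ = solve-∀
    sum≡ : suc k * (u * c) ≡ suc k * (D + v * c)
    sum≡ = begin
      suc k * (u * c) ≡⟨ eqU ⟨
      suc N * D ≡⟨ cong (D +_) eqV ⟩
      D + (k * D + suc k * (v * c)) ≡⟨ alg D k (v * c) ⟩
      suc k * (D + v * c) ∎
      where
      alg : ∀ x y z → x + (y * x + suc y * z) ≡ suc y * (x + z)
      alg = solve-∀
    eq : suc k * D ≡ suc k * ((u ∸ v) * c)
    eq = cong (suc k *_) (sym (begin
      (u ∸ v) * c ≡⟨ *-distribʳ-∸ c u v ⟩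
      u * c ∸ v * c ≡⟨ cong (_∸ v * c) (*-cancelˡ-≡ (u * c) (D + v * c) (suc k) sum≡) ⟩
      D + v * c ∸ v * c ≡⟨ m+n∸n≡m D (v * c) ⟩
      D ∎))

  -- Each of the n + 1 numbers (n + 1) C(n , k) divides D and so is at most D, while their sum is (n
  -- + 1) 2^n.
  common-multiple-≥ : ∀ {D} n → .{{NonZero D}} → (∀ j → 1 ≤ j → j ≤ suc n → j ∣ D) → 2 ^ n ≤ D
  common-multiple-≥ {D} n all = *-cancelˡ-≤ (suc n) (begin
    suc n * 2 ^ n             ≡⟨ cong (suc n *_) (rowSum-total n) ⟨
    suc n * rowSum n (suc n)  ≤⟨ go (suc n) ≤-refl ⟩
    suc n * D                 ∎)
    where
    open ≤-Reasoning
    go : ∀ k → k ≤ suc n → suc n * rowSum n k ≤ k * D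
    go zero _ = ≤-reflexive (*-zeroʳ (suc n))
    go (suc k) (s≤s k≤n) = begin
      suc n * (rowSum n k + n C k)          ≡⟨ *-distribˡ-+ (suc n) (rowSum n k) (n C k) ⟩
      suc n * rowSum n k + suc n * (n C k)  ≤⟨ +-mono-≤ (go k (m≤n⇒m≤1+n k≤n)) (∣⇒≤ (leibniz-∣ n k k≤n all)) ⟩
      k * D + D                             ≡⟨ +-comm (k * D) D ⟩
      suc k * D                             ∎

  -- A substitute for the primorial of 2^s: the primes in (2^i , 2^(i+1)] all divide the factor
  -- C(2^(i+1) , 2^i), and the product stays exponential in 2^s.
  centralProduct : ℕ → ℕ
  centralProduct zero = 1
  centralProduct (suc s) = centralProduct s * ((2 ^ suc s) C (2 ^ s))

  centralProduct-≤ : ∀ s → centralProduct s ≤ 2 ^ (2 ^ suc s)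
  centralProduct-≤ zero = s≤s z≤n
  centralProduct-≤ (suc s) = begin
    centralProduct s * ((2 ^ suc s) C (2 ^ s)) ≤⟨ *-mono-≤ (centralProduct-≤ s) (C≤2^ (2 ^ suc s) (2 ^ s)) ⟩
    2 ^ (2 ^ suc s) * 2 ^ (2 ^ suc s)          ≡⟨ ^-distribˡ-+-* 2 (2 ^ suc s) (2 ^ suc s) ⟨
    2 ^ (2 ^ suc s + 2 ^ suc s)                ≡⟨ cong (λ z → 2 ^ (2 ^ suc s + z)) (+-identityʳ _) ⟨
    2 ^ (2 ^ suc (suc s))                      ∎
    where open ≤-Reasoning

  prime-∣!⇒≤ : ∀ {p} n → Prime p → p ∣ n ! → p ≤ n
  prime-∣!⇒≤ zero pr p∣1 = ⊥-elim (¬prime[1] (subst Prime (∣1⇒≡1 p∣1) pr))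
  prime-∣!⇒≤ (suc n) pr d with euclidsLemma (suc n) (n !) pr d
  ... | inj₁ d₁ = ∣⇒≤ d₁
  ... | inj₂ d₂ = m≤n⇒m≤1+n (prime-∣!⇒≤ n pr d₂)

  ≤⇒∣! : ∀ {t} n → 1 ≤ t → t ≤ n → t ∣ n !
  ≤⇒∣! {suc t} n _ t≤n = ∣-trans (m∣m*n (t !)) (m≤n⇒m!∣n! t≤n)

  C-factorial : ∀ {n k} → k ≤ n → (n C k) * (k ! * (n ∸ k) !) ≡ n !
  C-factorial {n} {k} k≤n = begin
    (n C k) * (k ! * (n ∸ k) !) ≡⟨ cong (_* (k ! * (n ∸ k) !)) (nCk≡n!/k![n-k]! k≤n) ⟩
    _                           ≡⟨ m/n*n≡m (k![n∸k]!∣n! k≤n) ⟩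
    n !                         ∎
    where
    open ≡-Reasoning
    instance _ = k !* (n ∸ k) !≢0

  C-nonZero : ∀ {n k} → k ≤ n → NonZero (n C k)
  C-nonZero {n} {k} k≤n = m*n≢0⇒m≢0 (n C k) {{subst NonZero (sym (C-factorial k≤n)) (n !≢0)}}

  -- Such a prime divides (2n)! = C(2n , n) n! n! but, exceeding n, does not divide n!.
  prime-∣-central : ∀ {p} n → Prime p → n < p → p ≤ 2 * n → p ∣ (2 * n) C n
  prime-∣-central {p} n pr n<p p≤2n
    with euclidsLemma ((2 * n) C n) (n ! * (2 * n ∸ n) !) pr
           (subst (p ∣_) (sym (C-factorial (m≤m+n n (n + 0)))) (≤⇒∣! (2 * n) (≤-trans (s≤s z≤n) n<p) p≤2n))
  ... | inj₁ d = d
  ... | inj₂ d with euclidsLemma (n !) ((2 * n ∸ n) !) pr d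
  ...   | inj₁ d₁ = ⊥-elim (<⇒≱ n<p (prime-∣!⇒≤ n pr d₁))
  ...   | inj₂ d₂ = ⊥-elim (<⇒≱ n<p (subst (p ≤_) (trans (m+n∸m≡n n (n + 0)) (+-identityʳ n)) (prime-∣!⇒≤ (2 * n ∸ n) pr d₂)))

  prime-∣-centralProduct : ∀ {p} s → Prime p → p ≤ 2 ^ s → p ∣ centralProduct s
  prime-∣-centralProduct {p} zero pr p≤1 = ⊥-elim (<⇒≱ (nonTrivial⇒n>1 p {{prime⇒nonTrivial pr}}) p≤1)
  prime-∣-centralProduct {p} (suc s) pr p≤ with p ≤? 2 ^ s
  ... | yes q = ∣m⇒∣m*n _ (prime-∣-centralProduct s pr q)
  ... | no q = ∣n⇒∣m*n (centralProduct s) (prime-∣-central (2 ^ s) pr (≰⇒> q) p≤)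

  centralProduct-nonZero : ∀ s → NonZero (centralProduct s)
  centralProduct-nonZero zero = _
  centralProduct-nonZero (suc s) =
    m*n≢0 _ _ {{centralProduct-nonZero s}} {{C-nonZero (m≤m+n (2 ^ s) (2 ^ s + 0))}}

  prime-coprime : ∀ {p s} → Prime p → ¬ (p ∣ s) → Coprime s p
  prime-coprime pr p∤s (d∣s , d∣p) with prime⇒irreducible pr d∣p
  ... | inj₁ d≡1 = d≡1
  ... | inj₂ d≡p = ⊥-elim (p∤s (subst (_∣ _) d≡p d∣s))

  -- A prime that already divides s moves into t.
  square-part : ∀ {Q} ps → All Prime ps → All (_∣ Q) ps →
                ∃[ s ] ∃[ t ] (product ps ≡ s * (t * t) × s ∣ Q)
  square-part {Q} [] _ _ = 1 , 1 , refl , 1∣ Q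
  square-part {Q} (p ∷ ps) (pr ∷ prs) (p∣Q ∷ ps∣Q) with square-part ps prs ps∣Q
  ... | s , t , eq , s∣Q with p ∣? s
  ...   | yes (divides s′ s≡) = s′ , p * t , eq′ , ∣-trans (divides p (trans s≡ (*-comm s′ p))) s∣Q
    where
    alg : ∀ p s t → p * (s * p * (t * t)) ≡ s * (p * t * (p * t))
    alg = solve-∀
    eq′ : p * product ps ≡ s′ * (p * t * (p * t))
    eq′ = trans (cong (p *_) (trans eq (cong (_* (t * t)) s≡))) (alg p s′ t)
  ...   | no p∤s with p∣Q
  ...     | divides c Q≡cp = p * s , t , trans (cong (p *_) eq) (sym (*-assoc p s (t * t))) , ps∣Q′
    where
    s∣c : s ∣ c
    s∣c = coprime-divisor (prime-coprime pr p∤s) (subst (s ∣_) (trans Q≡cp (*-comm c p)) s∣Q)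
    ps∣Q′ : p * s ∣ Q
    ps∣Q′ = subst (p * s ∣_) (sym (trans Q≡cp (*-comm c p))) (*-monoʳ-∣ p s∣c)

  all-prime-divisors : ∀ ps → All Prime ps → ∀ {j} → product ps ∣ j → All (λ p → Prime p × p ∣ j) ps
  all-prime-divisors [] _ _ = []
  all-prime-divisors (p ∷ ps) (pr ∷ prs) d =
    (pr , ∣-trans (m∣m*n (product ps)) d) ∷ all-prime-divisors ps prs (∣-trans (n∣m*n p) d)

  -- With j = s t² and s a divisor of Q, the bound t² ≤ j ≤ T² makes t a divisor of T!. Prime powers
  -- in j are thus paid for by T!², and Q has to contain each prime only once.
  ∣-product-square : ∀ {Q T} j → 1 ≤ j → j ≤ T * T →
                     (∀ p → Prime p → p ∣ j → p ∣ Q) → j ∣ Q * (T ! * T !)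
  ∣-product-square {Q} {T} j@(suc _) _ j≤ prs∣ with factorise j
  ... | record { factors = ps ; isFactorisation = isF ; factorsPrime = prs }
    with square-part {Q} ps prs (All.map (λ { {p} (pr , d) → prs∣ p pr d }) (all-prime-divisors ps prs (subst (_∣ j) isF ∣-refl)))
  ... | s , t , eq , s∣Q = subst (_∣ Q * (T ! * T !)) (sym j≡) (*-pres-∣ s∣Q (*-pres-∣ t∣T t∣T))
    where
    j≡ : j ≡ s * (t * t)
    j≡ = trans isF eq
    1≤t : 1 ≤ t
    1≤t = n≢0⇒n>0 λ { refl → 1+n≢0 (trans j≡ (*-zeroʳ s)) }
    tt≤j : t * t ≤ j
    tt≤j = ∣⇒≤ (divides s j≡)
    t≤T : t ≤ T
    t≤T = ≮⇒≥ λ T<t → <⇒≱ (*-mono-< T<t T<t) (≤-trans tt≤j j≤)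
    t∣T : t ∣ T !
    t∣T = ≤⇒∣! T 1≤t t≤T

  n!≤n^n : ∀ n → n ! ≤ n ^ n
  n!≤n^n zero = ≤-refl
  n!≤n^n (suc n) = *-monoʳ-≤ (suc n) (≤-trans (n!≤n^n n) (^-monoˡ-≤ n (n≤1+n n)))

  n+2≤2^n : ∀ b → suc (suc b) + 2 ≤ 2 ^ suc (suc b)
  n+2≤2^n zero = ≤-refl
  n+2≤2^n (suc b) = begin
    suc (suc (suc b) + 2)              ≤⟨ +-monoˡ-≤ (suc (suc b) + 2) {1} {suc (suc b) + 2} (s≤s z≤n) ⟩
    (suc (suc b) + 2) + (suc (suc b) + 2) ≤⟨ +-mono-≤ (n+2≤2^n b) (n+2≤2^n b) ⟩
    2 ^ suc (suc b) + 2 ^ suc (suc b)  ≡⟨ cong (2 ^ suc (suc b) +_) (+-identityʳ _) ⟨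
    2 ^ suc (suc (suc b))              ∎
    where open ≤-Reasoning

  -- If there were no prime in the interval, Q · (T !)² would be a common multiple of
  -- 1 , … , T² smaller than 2 ^ (T² ∸ 1).
  prime-between : ∀ b → 2 ≤ b → ∃[ p ] (Prime p × 2 ^ (2 * b) < p × p ≤ 2 ^ (2 * (b + 2)))
  prime-between b 2≤b with anyUpTo? (λ p → prime? p ×-dec (2 ^ (2 * b) <? p)) (suc (2 ^ (2 * (b + 2))))
  ... | yes (p , s≤s p≤ , pr , lt) = p , pr , lt , p≤
  ... | no none = ⊥-elim (<⇒≱ small big)
    where
    open ≤-Reasoning
    h = 2 * b
    -- T² is the right end N = 16 y of the interval, where y = 4^b. Then Q ≤ 2^(2y), and T! ≤ 2^(4y)
    -- because b + 2 ≤ 2^b for b ≥ 2; so D ≤ 2^(10y) < 2^(16y - 1).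
    T = 2 ^ (b + 2)
    N = 2 ^ (2 * (b + 2))
    Q = centralProduct h
    D = Q * (T ! * T !)
    TT : T * T ≡ N
    TT = trans (sym (^-distribˡ-+-* 2 (b + 2) (b + 2))) (cong (λ z → 2 ^ (b + 2 + z)) (sym (+-identityʳ (b + 2))))
    N≡ : N ≡ suc (pred N)
    N≡ = sym (suc-pred N {{m^n≢0 2 (2 * (b + 2))}})
    primes∣ : ∀ {j} → 1 ≤ j → j ≤ N → ∀ p → Prime p → p ∣ j → p ∣ Q
    primes∣ {suc j} _ j≤ p pr p∣j with p ≤? 2 ^ h
    ... | yes q = prime-∣-centralProduct h pr q
    ... | no q = ⊥-elim (none (p , s≤s (≤-trans (∣⇒≤ p∣j) j≤) , pr , ≰⇒> q))
    big : 2 ^ pred N ≤ D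
    big = common-multiple-≥ (pred N) {{m*n≢0 Q _ {{centralProduct-nonZero h}} {{T !* T !≢0}}}}
      λ j 1≤j j≤ → ∣-product-square {Q} {T} j 1≤j (subst (j ≤_) (trans (sym N≡) (sym TT)) j≤)
                     (primes∣ 1≤j (subst (j ≤_) (sym N≡) j≤))
    T!≤ : T ! ≤ 2 ^ (2 ^ 2 * (2 ^ b * 2 ^ b))
    T!≤ = begin
      T !                      ≤⟨ n!≤n^n T ⟩
      T ^ T                    ≡⟨ ^-*-assoc 2 (b + 2) T ⟩
      2 ^ ((b + 2) * T)        ≤⟨ ^-monoʳ-≤ 2 (*-monoˡ-≤ T (b+2≤ b 2≤b)) ⟩
      2 ^ (2 ^ b * T)          ≡⟨ cong (λ z → 2 ^ (2 ^ b * z)) (^-distribˡ-+-* 2 b 2) ⟩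
      2 ^ (2 ^ b * (2 ^ b * 4)) ≡⟨ cong (2 ^_) (alg (2 ^ b)) ⟩
      2 ^ (4 * (2 ^ b * 2 ^ b)) ∎
      where
      b+2≤ : ∀ b → 2 ≤ b → b + 2 ≤ 2 ^ b
      b+2≤ (suc (suc b)) _ = n+2≤2^n b
      b+2≤ (suc zero) (s≤s ())
      alg : ∀ x → x * (x * 4) ≡ 4 * (x * x)
      alg = solve-∀
    y = 2 ^ h
    yy : 2 ^ b * 2 ^ b ≡ y
    yy = trans (sym (^-distribˡ-+-* 2 b b)) (cong (λ z → 2 ^ (b + z)) (sym (+-identityʳ b)))
    N≡16y : N ≡ 16 * y
    N≡16y = trans (cong (2 ^_) (alg b)) (^-distribˡ-+-* 2 4 h)
      where
      alg : ∀ b → 2 * (b + 2) ≡ 4 + 2 * b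
      alg = solve-∀
    D≤ : D ≤ 2 ^ (10 * y)
    D≤ = begin
      Q * (T ! * T !)  ≤⟨ *-mono-≤ (centralProduct-≤ h) (*-mono-≤ T!≤ T!≤) ⟩
      2 ^ (2 * y) * (2 ^ (4 * (2 ^ b * 2 ^ b)) * 2 ^ (4 * (2 ^ b * 2 ^ b)))
        ≡⟨ cong (λ z → 2 ^ (2 * y) * (2 ^ (4 * z) * 2 ^ (4 * z))) yy ⟩
      2 ^ (2 * y) * (2 ^ (4 * y) * 2 ^ (4 * y)) ≡⟨ cong (2 ^ (2 * y) *_) (^-distribˡ-+-* 2 (4 * y) (4 * y)) ⟨
      2 ^ (2 * y) * 2 ^ (4 * y + 4 * y) ≡⟨ ^-distribˡ-+-* 2 (2 * y) (4 * y + 4 * y) ⟨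
      2 ^ (2 * y + (4 * y + 4 * y)) ≡⟨ cong (2 ^_) (alg y) ⟩
      2 ^ (10 * y) ∎
      where
      alg : ∀ y → 2 * y + (4 * y + 4 * y) ≡ 10 * y
      alg = solve-∀
    small : D < 2 ^ pred N
    small = ≤-<-trans D≤ (^-monoʳ-< 2 (s≤s (s≤s z≤n)) (s≤s⁻¹ (begin-strict
      suc (10 * y)  <⟨ s≤s (≤-refl) ⟩
      2 + 10 * y    ≤⟨ +-monoˡ-≤ (10 * y) (*-mono-≤ {2} {6} {1} {y} (s≤s (s≤s z≤n)) (m^n>0 2 h)) ⟩
      6 * y + 10 * y ≡⟨ *-distribʳ-+ y 6 10 ⟨
      16 * y         ≡⟨ N≡16y ⟨
      N              ≡⟨ N≡ ⟩
      suc (pred N)   ∎)))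

-- The affine plane modulo p and perspectivities in a pencil

module AffinePlane where

  open import Data.Nat as ℕ using (ℕ; zero; suc)
  import Data.Nat.Properties as ℕ
  import Data.Nat.Divisibility as ℕ
  open import Data.Nat.Primality using (Prime; euclidsLemma; prime⇒nonZero; ¬prime[1])
  open import Data.Nat.Coprimality using (coprime-Bézout)
  open import Data.Nat.GCD using (module Bézout)
  open import Data.Integer using (ℤ; +_; -[1+_]; ∣_∣; _+_; _*_; _-_; -_; 0ℤ; 1ℤ; -1ℤ)
  open import Data.Integer.Properties using (+-inverseʳ; abs-*; *-comm; pos-*; neg-distribˡ-*)
  open import Data.Integer.Divisibility.Signed
  open import Data.Integer.DivMod using (_%ℕ_; _/ℕ_; a≡a%ℕn+[a/ℕn]*n; n%ℕd<d)
  open import Data.Integer.Tactic.RingSolver using (solve-∀)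
  open PrimeGap using (prime-coprime)

  module Modular {p : ℕ} (pr : Prime p) where

    infix 4 _≈_

    Null : ℤ → Set
    Null a = + p ∣ a

    _≈_ : ℤ → ℤ → Set
    a ≈ b = Null (a - b)

    Null-resp : ∀ {a b} → a ≡ b → Null b → Null a
    Null-resp refl n = n

    null-0 : Null 0ℤ
    null-0 = ∣ᵤ⇒∣ (p ℕ.∣0)

    -- Congruences below are proved by certificate: a ring identity over ℤ writes the target as a
    -- combination of differences already known to vanish modulo p.
    null-comb₂ : ∀ {a b} α β → Null a → Null b → Null (α * a + β * b)
    null-comb₂ α β na nb = ∣m∣n⇒∣m+n (∣n⇒∣m*n α na) (∣n⇒∣m*n β nb)

    null-comb₃ : ∀ {a b c} α β γ → Null a → Null b → Null c → Null (α * a + β * b + γ * c)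
    null-comb₃ α β γ na nb nc = ∣m∣n⇒∣m+n (null-comb₂ α β na nb) (∣n⇒∣m*n γ nc)

    null-comb₄ : ∀ {a b c d} α β γ δ → Null a → Null b → Null c → Null d →
                 Null (α * a + β * b + γ * c + δ * d)
    null-comb₄ α β γ δ na nb nc nd = ∣m∣n⇒∣m+n (null-comb₃ α β γ na nb nc) (∣n⇒∣m*n δ nd)

    ≈-refl : ∀ a → a ≈ a
    ≈-refl a = Null-resp (+-inverseʳ a) null-0

    ≈-reflexive : ∀ a b → a ≡ b → a ≈ b
    ≈-reflexive a _ refl = ≈-refl a

    ≈-sym : ∀ a b → a ≈ b → b ≈ a
    ≈-sym a b n = Null-resp (alg a b) (∣m⇒∣-m n)
      where
      alg : ∀ a b → b - a ≡ - (a - b)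
      alg = solve-∀

    null-product : ∀ a b → Null (a * b) → Null a ⊎ Null b
    null-product a b n with euclidsLemma ∣ a ∣ ∣ b ∣ pr (subst (p ℕ.∣_) (abs-* a b) (∣⇒∣ᵤ n))
    ... | inj₁ d = inj₁ (∣ᵤ⇒∣ d)
    ... | inj₂ d = inj₂ (∣ᵤ⇒∣ d)

    ¬null-1 : ¬ Null 1ℤ
    ¬null-1 n = ¬prime[1] (subst Prime (ℕ.∣1⇒≡1 (∣⇒∣ᵤ n)) pr)

    inverseℕ : ∀ n → ¬ p ℕ.∣ n → ∃[ b ] (+ n * b ≈ 1ℤ)
    inverseℕ n ¬d with coprime-Bézout (prime-coprime pr ¬d)
    ... | Bézout.+- s t eq = + s , Null-resp (lemma eq) (∣n⇒∣m*n (+ t) ∣-refl)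
      where
      lemma : 1 ℕ.+ t ℕ.* p ≡ s ℕ.* n → + n * + s - 1ℤ ≡ + t * + p
      lemma e = begin
        + n * + s - 1ℤ          ≡⟨ cong (_- 1ℤ) (*-comm (+ n) (+ s)) ⟩
        + s * + n - 1ℤ          ≡⟨ cong (_- 1ℤ) (pos-* s n) ⟨
        + (s ℕ.* n) - 1ℤ        ≡⟨ cong (λ z → + z - 1ℤ) e ⟨
        1ℤ + + (t ℕ.* p) - 1ℤ   ≡⟨ cong (λ z → 1ℤ + z - 1ℤ) (pos-* t p) ⟩
        1ℤ + + t * + p - 1ℤ     ≡⟨ alg (+ t * + p) ⟩
        + t * + p               ∎
        where
        open ≡-Reasoning
        alg : ∀ a → 1ℤ + a - 1ℤ ≡ a
        alg = solve-∀
    ... | Bézout.-+ s t eq = - + s , Null-resp (lemma eq) (∣n⇒∣m*n (- + t) ∣-refl)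
      where
      lemma : 1 ℕ.+ s ℕ.* n ≡ t ℕ.* p → + n * (- + s) - 1ℤ ≡ - + t * + p
      lemma e = begin
        + n * (- + s) - 1ℤ       ≡⟨ alg (+ n) (+ s) ⟩
        - (1ℤ + + s * + n)       ≡⟨ cong (λ z → - (1ℤ + z)) (pos-* s n) ⟨
        - (+ (1 ℕ.+ s ℕ.* n))    ≡⟨ cong (λ z → - (+ z)) e ⟩
        - (+ (t ℕ.* p))          ≡⟨ cong -_ (pos-* t p) ⟩
        - (+ t * + p)            ≡⟨ neg-distribˡ-* (+ t) (+ p) ⟩
        - + t * + p              ∎
        where
        open ≡-Reasoning
        alg : ∀ n s → n * (- s) - 1ℤ ≡ - (1ℤ + s * n)
        alg = solve-∀

    inverse : ∀ a → ¬ Null a → ∃[ b ] (a * b ≈ 1ℤ)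
    inverse (+ n) ¬na = inverseℕ n (λ d → ¬na (∣ᵤ⇒∣ d))
    inverse -[1+ n ] ¬na with inverseℕ (suc n) (λ d → ¬na (∣ᵤ⇒∣ d))
    ... | b , eq = - b , Null-resp (cong (_- 1ℤ) (alg (+ suc n) b)) eq
      where
      alg : ∀ a b → - a * - b ≡ a * b
      alg = solve-∀

    residue : ∀ a → ∃[ r ] (r ℕ.< p × a ≈ + r)
    residue a = a %ℕ p , n%ℕd<d a p , Null-resp eq (∣n⇒∣m*n (a /ℕ p) ∣-refl)
      where
      instance _ = prime⇒nonZero pr
      eq : a - + (a %ℕ p) ≡ (a /ℕ p) * + p
      eq = trans (cong (_- + (a %ℕ p)) (a≡a%ℕn+[a/ℕn]*n a p)) (alg (+ (a %ℕ p)) ((a /ℕ p) * + p))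
        where
        alg : ∀ r q → r + q - r ≡ q
        alg = solve-∀

    one-product : ∀ {a b} → a ≈ 1ℤ → b ≈ 1ℤ → a * b ≈ 1ℤ
    one-product {a} {b} ea eb = Null-resp (alg a b) (null-comb₂ 1ℤ a ea eb)
      where
      alg : ∀ a b → a * b - 1ℤ ≡ 1ℤ * (a - 1ℤ) + a * (b - 1ℤ)
      alg = solve-∀

    -- Points (x , y) and lines Y = z X - w, modulo p.
    module Plane {Pt Ln : Set} (x y : Pt → ℤ) (z w : Ln → ℤ)
      (y-cong : ∀ a b → x a ≈ x b → y a ≈ y b)
      (w-cong : ∀ l m → z l ≈ z m → w l ≈ w m)
      where

      infix 4 _on_

      record _on_ (a : Pt) (l : Ln) : Set where
        constructor incident
        field equation : x a * z l ≈ y a + w l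
      open _on_

      on-resp-pt : ∀ {a b l} → x a ≈ x b → a on l → b on l
      on-resp-pt {a} {b} {l} e h =
        incident (Null-resp (alg (x a) (x b) (y a) (y b) (z l) (w l)) (null-comb₃ 1ℤ (- z l) 1ℤ (equation h) e (y-cong a b e)))
        where
        alg : ∀ xa xb ya yb z w → xb * z - (yb + w) ≡ 1ℤ * (xa * z - (ya + w)) + - z * (xa - xb) + 1ℤ * (ya - yb)
        alg = solve-∀

      on-resp-ln : ∀ {a l m} → z l ≈ z m → a on l → a on m
      on-resp-ln {a} {l} {m} e h =
        incident (Null-resp (alg (x a) (y a) (z l) (z m) (w l) (w m)) (null-comb₃ 1ℤ (- x a) 1ℤ (equation h) e (w-cong l m e)))
        where
        alg : ∀ x y zl zm wl wm → x * zm - (y + wm) ≡ 1ℤ * (x * zl - (y + wl)) + - x * (zl - zm) + 1ℤ * (wl - wm)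
        alg = solve-∀

      -- The alternating sum of the four incidence equations is (x a - x b)(z l - z m), and p is
      -- prime.
      two-points : ∀ {a b l m} → a on l → a on m → b on l → b on m → x a ≈ x b ⊎ z l ≈ z m
      two-points {a} {b} {l} {m} al am bl bm = null-product (x a - x b) (z l - z m)
        (Null-resp (alg (x a) (x b) (y a) (y b) (z l) (z m) (w l) (w m)) (null-comb₄ 1ℤ -1ℤ -1ℤ 1ℤ (equation al) (equation am) (equation bl) (equation bm)))
        where
        alg : ∀ xa xb ya yb zl zm wl wm → (xa - xb) * (zl - zm) ≡
              1ℤ * (xa * zl - (ya + wl)) + -1ℤ * (xa * zm - (ya + wm)) + -1ℤ * (xb * zl - (yb + wl)) + 1ℤ * (xb * zm - (yb + wm))
        alg = solve-∀

      off-line : ∀ {a b l m} → a on l → a on m → b on l → ¬ x b ≈ x a → ¬ z l ≈ z m → ¬ b on m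
      off-line {a} {b} {l} {m} al am bl xne zne bm = [ xne , zne ]′ (two-points {b} {a} {l} {m} bl bm al am)

      module Closed
        (join : ∀ a b → ¬ x a ≈ x b → ∃[ l ] (a on l × b on l))
        (meet : ∀ l m → ¬ z l ≈ z m → ∃[ a ] (a on l × a on m))
        where

        module _ (F : Pt) where

          record Pencil (L M N : Ln) : Set where
            field
              FL : F on L
              FM : F on M
              FN : F on N
              LM : ¬ z L ≈ z M
              LN : ¬ z L ≈ z N
              MN : ¬ z M ≈ z N

          swap-pencil : ∀ {L M N} → Pencil L M N → Pencil M L N
          swap-pencil {L} {M} P = record { FL = FM ; FM = FL ; FN = FN ; LM = λ e → LM (≈-sym (z M) (z L) e) ; LN = MN ; MN = LN }
            where open Pencil P

          offset : Pt → ℤ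
          offset a = x a - x F

          -- The right side, the defect of F on l, does not depend on m. So along a line l off F the
          -- reciprocal offset is an affine function of the slope of the pencil line, and three
          -- pencil lines give a linear relation between three reciprocals.
          offset-eq : ∀ {a l m} → a on l → a on m → F on m →
                      offset a * (z l - z m) ≈ (w l + y F - x F * z l)
          offset-eq {a} {l} {m} al am Fm =
            Null-resp (alg (x a) (x F) (y a) (y F) (z l) (z m) (w l) (w m)) (null-comb₃ 1ℤ -1ℤ 1ℤ (equation al) (equation am) (equation Fm))
            where
            alg : ∀ xa xF ya yF zl zm wl wm → (xa - xF) * (zl - zm) - (wl + yF - xF * zl) ≡
                  1ℤ * (xa * zl - (ya + wl)) + -1ℤ * (xa * zm - (ya + wm)) + 1ℤ * (xF * zm - (yF + wm))
            alg = solve-∀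

          -- Projecting L onto M from a centre C on N is affine in the reciprocals
          -- of the offsets from F.
          perspectivity : ∀ {L M N C X} → Pencil L M N → C on N → ¬ x C ≈ x F → X on L → ¬ x X ≈ x F →
            ∃[ Y ] (Y on M × ¬ x Y ≈ x F × (∀ U V W → offset X * U ≈ 1ℤ → offset Y * V ≈ 1ℤ → offset C * W ≈ 1ℤ →
                    Null ((z M - z N) * U + (z N - z L) * V + (z L - z M) * W)))
          perspectivity {L} {M} {N} {C} {X} P CN C≠F XL X≠F = Y , YM , Y≠F , rel
            where
            open Pencil P
            C∉L : ¬ C on L
            C∉L = off-line {F} {C} {N} {L} FN FL CN C≠F (λ e → LN (≈-sym (z N) (z L) e))
            C∉M : ¬ C on M
            C∉M = off-line {F} {C} {N} {M} FN FM CN C≠F (λ e → MN (≈-sym (z N) (z M) e))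
            joined = join C X (λ e → C∉L (on-resp-pt {X} {C} {L} (≈-sym (x C) (x X) e) XL))
            l = proj₁ joined
            Cl = proj₁ (proj₂ joined)
            Xl = proj₂ (proj₂ joined)
            met = meet l M (λ e → C∉M (on-resp-ln {C} {l} {M} e Cl))
            Y = proj₁ met
            Yl = proj₁ (proj₂ met)
            YM = proj₂ (proj₂ met)
            -- A line l through F would share F and X with L, hence have the slope of L and coincide
            -- with it; but C is on l and not on L.
            F∉l : ¬ F on l
            F∉l Fl = [ (λ e → X≠F (≈-sym (x F) (x X) e)) , (λ e → C∉L (on-resp-ln {C} {l} {L} e Cl)) ]′
                     (two-points {F} {X} {l} {L} Fl FL Xl XL)
            Y≠F : ¬ x Y ≈ x F
            Y≠F e = F∉l (on-resp-pt {Y} {F} {l} e Yl)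
            c = offset C
            u = offset X
            v = offset Y
            τ = w l + y F - x F * z l
            -- The slope s and the defect τ of l are eliminated from u (s - λ′) = τ, v (s - μ) = τ
            -- and c (s - ν) = τ. Division by u v c, as multiplication by U V W, then turns this
            -- into the relation between reciprocals.
            alg : ∀ s λ′ μ ν u v c τ → (μ - ν) * (v * c) + (ν - λ′) * (u * c) + (λ′ - μ) * (u * v) ≡
                  (v - u) * (c * (s - ν) - τ) + (u - c) * (v * (s - μ) - τ) + (c - v) * (u * (s - λ′) - τ)
            alg = solve-∀
            rel₀ : Null ((z M - z N) * (v * c) + (z N - z L) * (u * c) + (z L - z M) * (u * v))
            rel₀ = Null-resp (alg (z l) (z L) (z M) (z N) u v c τ)
              (null-comb₃ (v - u) (u - c) (c - v) (offset-eq {C} {l} {N} Cl CN FN) (offset-eq {Y} {l} {M} Yl YM FM) (offset-eq {X} {l} {L} Xl XL FL))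
            alg₂ : ∀ α β γ u v c U V W → α * U + β * V + γ * W ≡
                   (U * V * W) * (α * (v * c) + β * (u * c) + γ * (u * v))
                   + - (α * U) * ((v * V) * (c * W) - 1ℤ) + - (β * V) * ((u * U) * (c * W) - 1ℤ) + - (γ * W) * ((u * U) * (v * V) - 1ℤ)
            alg₂ = solve-∀
            rel : ∀ U V W → u * U ≈ 1ℤ → v * V ≈ 1ℤ → c * W ≈ 1ℤ →
                  Null ((z M - z N) * U + (z N - z L) * V + (z L - z M) * W)
            rel U V W eU eV eW = Null-resp (alg₂ (z M - z N) (z N - z L) (z L - z M) u v c U V W)
              (null-comb₄ (U * V * W) (- ((z M - z N) * U)) (- ((z N - z L) * V)) (- ((z L - z M) * W))
                rel₀ (one-product {v * V} {c * W} eV eW) (one-product {u * U} {c * W} eU eW) (one-product {u * U} {v * V} eU eV))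

          -- The two perspectivities L → M → L with centres C₁, C₂ compose to an elation:
          -- the reciprocal offset U becomes U + K with K ≠ 0.  Since p is prime some
          -- iterate has U = 0, which is impossible for a reciprocal.
          no-pencil : ∀ {L M N C₁ C₂ X} → Pencil L M N → C₁ on N → C₂ on N → ¬ x C₁ ≈ x F → ¬ x C₂ ≈ x F →
                      ¬ x C₁ ≈ x C₂ → X on L → ¬ x X ≈ x F → ⊥
          no-pencil {L} {M} {N} {C₁} {C₂} {X} P C₁N C₂N C₁≠F C₂≠F C₁≠C₂ XL X≠F = contra
            where
            open Pencil P
            c₁ = offset C₁
            c₂ = offset C₂
            l = z L
            m = z M
            ν = z N
            W₁ = proj₁ (inverse c₁ C₁≠F)
            eW₁ = proj₂ (inverse c₁ C₁≠F)
            W₂ = proj₁ (inverse c₂ C₂≠F)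
            eW₂ = proj₂ (inverse c₂ C₂≠F)
            ρ = proj₁ (inverse (m - ν) MN)
            eρ = proj₂ (inverse (m - ν) MN)
            -- The relations of the two perspectivities have opposite coefficients at V, so their
            -- sum is (m - ν)(U - U′) + (l - m)(W₁ - W₂) = 0. Solved for U′ - U this gives K.
            K = ρ * ((l - m) * (W₁ - W₂))
            U₀ = proj₁ (inverse (offset X) X≠F)
            eU₀ = proj₂ (inverse (offset X) X≠F)

            State : ℕ → Set
            State n = ∃[ A ] (A on L × ¬ x A ≈ x F × ∃[ U ] (offset A * U ≈ 1ℤ × U ≈ (U₀ + + n * K)))

            step : ∀ n → State n → State (suc n)
            step n (A , AL , A≠F , U , eU , U≈) = A′ , A′L , A′≠F , U′ , eU′ , U′≈
              where
              π₁ = perspectivity {L} {M} {N} {C₁} {A} P C₁N C₁≠F AL A≠F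
              B = proj₁ π₁
              BM = proj₁ (proj₂ π₁)
              B≠F = proj₁ (proj₂ (proj₂ π₁))
              π₂ = perspectivity {M} {L} {N} {C₂} {B} (swap-pencil P) C₂N C₂≠F BM B≠F
              A′ = proj₁ π₂
              A′L = proj₁ (proj₂ π₂)
              A′≠F = proj₁ (proj₂ (proj₂ π₂))
              V = proj₁ (inverse (offset B) B≠F)
              eV = proj₂ (inverse (offset B) B≠F)
              U′ = proj₁ (inverse (offset A′) A′≠F)
              eU′ = proj₂ (inverse (offset A′) A′≠F)
              r₁ = proj₂ (proj₂ (proj₂ π₁)) U V W₁ eU eV eW₁
              r₂ = proj₂ (proj₂ (proj₂ π₂)) V U′ W₂ eV eU′ eW₂
              alg : ∀ l m ν U V U′ W₁ W₂ ρ U₀ n →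
                U′ - (U₀ + (1ℤ + n) * (ρ * ((l - m) * (W₁ - W₂)))) ≡
                1ℤ * (U - (U₀ + n * (ρ * ((l - m) * (W₁ - W₂)))))
                + (U - U′) * ((m - ν) * ρ - 1ℤ)
                + - ρ * ((m - ν) * U + (ν - l) * V + (l - m) * W₁)
                + - ρ * ((l - ν) * V + (ν - m) * U′ + (m - l) * W₂)
              alg = solve-∀
              U′≈ : U′ ≈ (U₀ + + suc n * K)
              U′≈ = Null-resp (alg l m ν U V U′ W₁ W₂ ρ U₀ (+ n))
                (null-comb₄ 1ℤ (U - U′) (- ρ) (- ρ) U≈ eρ r₁ r₂)

            states : ∀ n → State n
            states zero = X , XL , X≠F , U₀ , eU₀ , Null-resp (alg U₀ K) null-0
              where
              alg : ∀ a k → a - (a + 0ℤ * k) ≡ 0ℤ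
              alg = solve-∀
            states (suc n) = step n (states n)

            W₁≠W₂ : ¬ Null (W₁ - W₂)
            W₁≠W₂ e = C₁≠C₂ (Null-resp (alg (x C₁) (x C₂) (x F) W₁ W₂)
              (null-comb₃ (- (c₁ * c₂)) c₁ (- c₂) e eW₂′ eW₁′))
              where
              eW₁′ : (1ℤ - c₁ * W₁) ≈ 0ℤ
              eW₁′ = Null-resp (alg₁ (c₁ * W₁)) (∣m⇒∣-m eW₁)
                where
                alg₁ : ∀ a → (1ℤ - a) - 0ℤ ≡ - (a - 1ℤ)
                alg₁ = solve-∀
              eW₂′ : (1ℤ - c₂ * W₂) ≈ 0ℤ
              eW₂′ = Null-resp (alg₁ (c₂ * W₂)) (∣m⇒∣-m eW₂)
                where
                alg₁ : ∀ a → (1ℤ - a) - 0ℤ ≡ - (a - 1ℤ)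
                alg₁ = solve-∀
              alg : ∀ x₁ x₂ f W₁ W₂ → x₁ - x₂ ≡
                    - ((x₁ - f) * (x₂ - f)) * (W₁ - W₂) + (x₁ - f) * ((1ℤ - (x₂ - f) * W₂) - 0ℤ) + - (x₂ - f) * ((1ℤ - (x₁ - f) * W₁) - 0ℤ)
              alg = solve-∀

            K≠0 : ¬ Null K
            K≠0 e = [ (λ e₁ → ¬null-1 (Null-resp (alg (m - ν) ρ) (null-comb₂ (m - ν) -1ℤ e₁ eρ)))
                    , (λ e₂ → [ LM , W₁≠W₂ ]′ (null-product (l - m) (W₁ - W₂) e₂)) ]′
                    (null-product ρ ((l - m) * (W₁ - W₂)) e)
              where
              alg : ∀ a r → 1ℤ ≡ a * r + -1ℤ * (a * r - 1ℤ)
              alg = solve-∀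

            contra : ⊥
            contra =
              let κ , eκ = inverse K K≠0
                  -- The number of steps is a natural representative of -U₀ / K.
                  r , _ , er = residue (- (U₀ * κ))
                  A , _ , _ , U , eU , U≈ = states r
              in ¬null-1 (Null-resp (alg (offset A) U U₀ (+ r) K κ)
                   (null-comb₄ -1ℤ (offset A) (- (offset A * U₀)) (- (offset A * K)) eU U≈ eκ er))
              where
              alg : ∀ u U U₀ r K κ → 1ℤ ≡
                    -1ℤ * (u * U - 1ℤ) + u * (U - (U₀ + r * K)) + - (u * U₀) * (K * κ - 1ℤ) + - (u * K) * (- (U₀ * κ) - r)
              alg = solve-∀

-- Counting the entries of a 0/1 matrix that avoids a small pattern

module ZeroOneMatrix where

  open import Data.Nat using (ℕ)
  open import Data.Fin using (Fin; _<_)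
  open import Data.Fin.Patterns using (0F; 1F; 2F; 3F)
  open import Data.Fin.Properties using (any?; _<?_; <-cmp; <⇒≢; <-trans)
  open import Relation.Binary.Definitions using (tri<; tri≈; tri>)

  -- Labels of the entries of a 0/1 matrix with rows x and columns z.  Unless the
  -- forbidden pattern occurs, distinct entries have distinct labels, so that there
  -- are at most 4p entries.
  module Labelling {p : ℕ} (D : Fin p → Fin p → Set) (D? : ∀ x z → Dec (D x z)) where

    -- A column has one lowest and one highest entry, a row one leftmost entry. Any other entry has
    -- entries on both sides in its column and one to its left; these witnesses are kept because two
    -- such entries in one row produce the forbidden pattern.
    data Label (x z : Fin p) : Fin 4 × Fin p → Set where
      lowest     : (∀ x′ → x′ < x → ¬ D x′ z) → Label x z (0F , z)
      highest    : (∀ x′ → x < x′ → ¬ D x′ z) → Label x z (1F , z)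
      leftmost   : (∀ z′ → z′ < z → ¬ D x z′) → Label x z (2F , x)
      interior   : ∀ {x₁ x₂ z₀} → x₁ < x → x < x₂ → z₀ < z → D x₁ z → D x₂ z → D x z₀ → Label x z (3F , x)

    label : ∀ x z → ∃ (Label x z)
    label x z with any? (λ x′ → (x′ <? x) ×-dec D? x′ z)
                 | any? (λ x′ → (x <? x′) ×-dec D? x′ z)
                 | any? (λ z′ → (z′ <? z) ×-dec D? x z′)
    ... | no none | _ | _ = _ , lowest λ x′ lt d → none (x′ , lt , d)
    ... | yes _ | no none | _ = _ , highest λ x′ lt d → none (x′ , lt , d)
    ... | yes _ | yes _ | no none = _ , leftmost λ z′ lt d → none (z′ , lt , d)
    ... | yes (_ , lt₁ , d₁) | yes (_ , lt₂ , d₂) | yes (_ , lt₀ , d₀) = _ , interior lt₁ lt₂ lt₀ d₁ d₂ d₀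

    -- The configuration of `no-pencil` with rows as points and columns as lines: three lines
    -- through the point x, two further points on z, one further point on z′.
    Forbidden : Set
    Forbidden = ∀ {x x₁ x₂ x₃ z z′ z″} → x₁ ≢ x → x₂ ≢ x → x₁ ≢ x₂ → x₃ ≢ x →
                z ≢ z′ → z ≢ z″ → z′ ≢ z″ →
                D x z → D x z′ → D x z″ → D x₁ z → D x₂ z → D x₃ z′ → ⊥

    label-injective : Forbidden → ∀ {x z x′ z′ c} → D x z → D x′ z′ → Label x z c → Label x′ z′ c →
                      x ≡ x′ × z ≡ z′
    label-injective forb {x} {z} {x′} {z′} d d′ (lowest f) (lowest g) with <-cmp x x′
    ... | tri< lt _ _ = ⊥-elim (g x lt d)
    ... | tri≈ _ eq _ = eq , refl
    ... | tri> _ _ gt = ⊥-elim (f x′ gt d′)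
    label-injective forb {x} {z} {x′} {z′} d d′ (highest f) (highest g) with <-cmp x x′
    ... | tri< lt _ _ = ⊥-elim (f x′ lt d′)
    ... | tri≈ _ eq _ = eq , refl
    ... | tri> _ _ gt = ⊥-elim (g x gt d)
    label-injective forb {x} {z} {x′} {z′} d d′ (leftmost f) (leftmost g) with <-cmp z z′
    ... | tri< lt _ _ = ⊥-elim (g z lt d)
    ... | tri≈ _ eq _ = refl , eq
    ... | tri> _ _ gt = ⊥-elim (f z′ gt d′)
    label-injective forb {x} {z} {_} {z′} d d′
      (interior lt₁ lt₂ lt₀ d₁ d₂ d₀) (interior lt₁′ lt₂′ lt₀′ d₁′ d₂′ d₀′) with <-cmp z z′
    -- The left one of the two interior entries supplies two further points in its column and the
    -- third column `z₀`; the right one supplies a further point in its own column.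
    ... | tri< lt _ _ = ⊥-elim (forb (<⇒≢ lt₁) (≢-sym (<⇒≢ lt₂)) (<⇒≢ (<-trans lt₁ lt₂)) (<⇒≢ lt₁′)
                                     (<⇒≢ lt) (≢-sym (<⇒≢ lt₀)) (≢-sym (<⇒≢ (<-trans lt₀ lt))) d d′ d₀ d₁ d₂ d₁′)
    ... | tri≈ _ eq _ = refl , eq
    ... | tri> _ _ gt = ⊥-elim (forb (<⇒≢ lt₁′) (≢-sym (<⇒≢ lt₂′)) (<⇒≢ (<-trans lt₁′ lt₂′)) (<⇒≢ lt₁)
                                     (<⇒≢ gt) (≢-sym (<⇒≢ lt₀′)) (≢-sym (<⇒≢ (<-trans lt₀′ gt))) d′ d d₀′ d₁′ d₂′ d₁)

-- Transversal edges and tight paths of length at most 3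

module TransversalEdges where

  open import Defs
  open import Data.Nat as ℕ using (ℕ; zero; suc; z≤n; s≤s)
  import Data.Nat.Properties as ℕ
  open import Data.Fin as Fin using (Fin; zero; suc)
  open import Data.Fin.Properties using (suc-injective)
  open import Data.Fin.Subset using (Subset; _∈_; _∉_; ∣_∣; inside; outside) renaming (⊥ to ∅)
  open import Data.Fin.Subset.Properties using (∣⊥∣≡0; ∉⊥)
  open import Data.Vec using ([]; _∷_; _[_]≔_)
  open import Data.Vec.Base using (here; there)
  open import Function using (_∘_)
  open import Function.Bundles using (_⇔_; mk⇔; Equivalence)

  image : ∀ {k n} → (Fin k → Fin n) → Subset n
  image {zero} v = ∅
  image {suc k} v = image (v ∘ suc) [ v zero ]≔ inside

  ∈-insert : ∀ {n} (p : Subset n) i → i ∈ p [ i ]≔ inside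
  ∈-insert (_ ∷ _) zero = here
  ∈-insert (_ ∷ p) (suc i) = there (∈-insert p i)

  ∈-insert-other : ∀ {n x} (p : Subset n) i → x ∈ p → x ∈ p [ i ]≔ inside
  ∈-insert-other (_ ∷ _) zero here = here
  ∈-insert-other (_ ∷ _) zero (there h) = there h
  ∈-insert-other (_ ∷ _) (suc i) here = here
  ∈-insert-other (_ ∷ p) (suc i) (there h) = there (∈-insert-other p i h)

  ∈-insert⁻ : ∀ {n x} (p : Subset n) i → x ∈ p [ i ]≔ inside → x ≢ i → x ∈ p
  ∈-insert⁻ (_ ∷ _) zero here x≢i = ⊥-elim (x≢i refl)
  ∈-insert⁻ (_ ∷ _) zero (there h) _ = there h
  ∈-insert⁻ (_ ∷ _) (suc i) here _ = here
  ∈-insert⁻ (_ ∷ p) (suc i) (there h) x≢i = there (∈-insert⁻ p i h (x≢i ∘ cong suc))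

  ∣insert∣ : ∀ {n} (p : Subset n) i → i ∉ p → ∣ p [ i ]≔ inside ∣ ≡ suc ∣ p ∣
  ∣insert∣ (inside ∷ _) zero i∉p = ⊥-elim (i∉p here)
  ∣insert∣ (outside ∷ _) zero _ = refl
  ∣insert∣ (inside ∷ p) (suc i) i∉p = cong suc (∣insert∣ p i (i∉p ∘ there))
  ∣insert∣ (outside ∷ p) (suc i) i∉p = ∣insert∣ p i (i∉p ∘ there)

  ∈-image⁺ : ∀ {k n} (v : Fin k → Fin n) j → v j ∈ image v
  ∈-image⁺ v zero = ∈-insert (image (v ∘ suc)) (v zero)
  ∈-image⁺ v (suc j) = ∈-insert-other (image (v ∘ suc)) (v zero) (∈-image⁺ (v ∘ suc) j)

  ∈-image⁻ : ∀ {k n} (v : Fin k → Fin n) {x} → x ∈ image v → ∃[ j ] v j ≡ x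
  ∈-image⁻ {zero} v x∈ = ⊥-elim (∉⊥ x∈)
  ∈-image⁻ {suc k} v {x} x∈ with x Fin.≟ v zero
  ... | yes eq = zero , sym eq
  ... | no ne = let j , eq = ∈-image⁻ (v ∘ suc) (∈-insert⁻ (image (v ∘ suc)) (v zero) x∈ ne) in suc j , eq

  ∣image∣ : ∀ {k n} (v : Fin k → Fin n) → (∀ i j → v i ≡ v j → i ≡ j) → ∣ image v ∣ ≡ k
  ∣image∣ {zero} {n} v _ = ∣⊥∣≡0 n
  ∣image∣ {suc k} v inj = trans (∣insert∣ (image (v ∘ suc)) (v zero) fresh)
    (cong suc (∣image∣ (v ∘ suc) (λ i j eq → suc-injective (inj (suc i) (suc j) eq))))
    where
    fresh : v zero ∉ image (v ∘ suc)
    fresh h with ∈-image⁻ (v ∘ suc) h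
    ... | j , eq with inj (suc j) zero eq
    ...   | ()

  module Transversals {n m W : ℕ} (ι : Fin (suc (suc m)) → Fin W → Fin n)
    (ι-injective : ∀ {i j a b} → ι i a ≡ ι j b → i ≡ j × a ≡ b) where

    k : ℕ
    k = suc (suc m)

    -- Phrased through membership, as the edges of a `TightPath` are; the edge still determines the
    -- tuple, by `vertex⁻`.
    IsTransversal : Subset n → (Fin k → Fin W) → Set
    IsTransversal e t = ∀ x → x ∈ e ⇔ (∃[ j ] ι j (t j) ≡ x)

    transversal : (Fin k → Fin W) → Subset n
    transversal t = image (λ j → ι j (t j))

    transversal-isTransversal : ∀ t → IsTransversal (transversal t) t
    transversal-isTransversal t x = mk⇔ (∈-image⁻ v) λ { (j , refl) → ∈-image⁺ v j }
      where
      v : Fin k → Fin n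
      v j = ι j (t j)

    ∣transversal∣ : ∀ t → ∣ transversal t ∣ ≡ k
    ∣transversal∣ t = ∣image∣ (λ j → ι j (t j)) λ i j eq → proj₁ (ι-injective {i} {j} {t i} {t j} eq)

    vertex : ∀ {e t} → IsTransversal e t → ∀ j → ι j (t j) ∈ e
    vertex T j = Equivalence.from (T _) (j , refl)

    vertex⁻ : ∀ {e t j a} → IsTransversal e t → ι j a ∈ e → t j ≡ a
    vertex⁻ {t = t} {j} {a} T h with Equivalence.to (T (ι j a)) h
    ... | i , eq with ι-injective eq
    ...   | refl , eq′ = eq′

    transversal-injective : ∀ s t → transversal s ≡ transversal t → ∀ j → s j ≡ t j
    transversal-injective s t eq j =
      sym (vertex⁻ (transversal-isTransversal t) (subst (ι j (s j) ∈_) eq (vertex (transversal-isTransversal s) j)))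

    -- A tight path meets the k parts cyclically, so two vertices of one part are
    -- at distance 2 modulo k, and a path of length 2 has all inner vertices on both edges.
    exchange : ∀ {P : Subset n → Set} → (∀ {e} → P e → ∃[ t ] IsTransversal e t) → DiamAtMost k P 3 →
      ∀ {e e′ t t′} → P e → IsTransversal e t → P e′ → IsTransversal e′ t′ → ∀ j → t j ≢ t′ j →
      ∃[ f ] ∃[ f′ ] ∃[ s ] ∃[ s′ ] (P f × P f′ × IsTransversal f s × IsTransversal f′ s′
        × s j ≡ t j × s′ j ≡ t′ j × (∀ i → i ≢ j → s i ≡ s′ i))
    exchange {P} transP diam {e} {e′} {t} {t′} Pe Te Pe′ Te′ j t≢t′
      with diam (ι j (t j)) (ι j (t′ j)) (e , Pe , vertex Te j) (e′ , Pe′ , vertex Te′ j)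
                (λ eq → t≢t′ (proj₂ (ι-injective eq)))
    ... | zero , () , _
    ... | suc (suc (suc (suc _))) , _ , s≤s (s≤s (s≤s ())) , _
    -- Length 1 puts both endpoints on one edge, which has a single vertex in part j.
    ... | 1 , _ , _ , v , inj , edge , v₀ , v₁ with edge 0 (s≤s z≤n)
    ...   | f , Pf , mem with transP Pf
    ...     | s , Tf = ⊥-elim (t≢t′ (trans
                (sym (vertex⁻ Tf (Equivalence.from (mem _) (0 , s≤s z≤n , v₀))))
                (vertex⁻ Tf (Equivalence.from (mem _) (suc m , ℕ.≤-refl , v₁)))))
    exchange {P} transP diam {e} {e′} {t} {t′} Pe Te Pe′ Te′ j t≢t′ | 2 , _ , _ , v , inj , edge , v₀ , v₁
      with edge 0 (s≤s z≤n) | edge 1 (s≤s (s≤s z≤n))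
    ... | f , Pf , mem | f′ , Pf′ , mem′ with transP Pf | transP Pf′
    ...   | s , Tf | s′ , Tf′ = f , f′ , s , s′ , Pf , Pf′ , Tf , Tf′
        , vertex⁻ Tf (Equivalence.from (mem _) (0 , s≤s z≤n , v₀))
        , vertex⁻ Tf′ (Equivalence.from (mem′ _) (suc m , ℕ.≤-refl , v₁))
        , agree
      where
      agree : ∀ i → i ≢ j → s i ≡ s′ i
      agree i i≢j with Equivalence.to (mem _) (vertex Tf i)
      ... | zero , _ , eq = ⊥-elim (i≢j (proj₁ (ι-injective (trans (sym eq) v₀))))
      ... | suc c , s≤s c< , eq = sym (vertex⁻ Tf′ (Equivalence.from (mem′ _) (c , ℕ.m≤n⇒m≤1+n c< , eq)))
    exchange {P} transP diam {e} {e′} {t} {t′} Pe Te Pe′ Te′ j t≢t′ | 3 , _ , _ , v , inj , edge , v₀ , v₁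
      with edge 0 (s≤s z≤n) | edge 1 (s≤s (s≤s z≤n)) | edge 2 (s≤s (s≤s (s≤s z≤n)))
    ... | f , Pf , mem | f′ , Pf′ , mem′ | f″ , Pf″ , mem″ with transP Pf | transP Pf′ | transP Pf″
    ...   | s , Tf | s′ , Tf′ | s″ , Tf″ = ⊥-elim absurd
      where
      absurd : ⊥
      -- Let i be the part of v 1. The last edge also has a vertex in part i. If it is the endpoint,
      -- then i = j and v 0 , v 1 are two vertices of part j on the first edge; otherwise it lies on
      -- the middle edge together with v 1. Either way two vertices of the path coincide.
      absurd with Equivalence.to (Tf (v 1)) (Equivalence.from (mem (v 1)) (1 , s≤s (s≤s z≤n) , refl))
      ... | i , eq with Equivalence.to (mem″ _) (vertex Tf″ i)
      ...   | c , c<k , eq″ with c ℕ.≟ suc m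
      ...     | yes refl with ι-injective (trans (sym eq″) v₁)
      ...       | refl , _ = ℕ.1+n≢0 (inj 1 0 (s≤s (s≤s z≤n)) (s≤s z≤n)
                    (trans (sym eq) (trans (cong (ι j) (vertex⁻ Tf (Equivalence.from (mem _) (0 , s≤s z≤n , v₀)))) (sym v₀))))
      absurd | i , eq | c , s≤s c≤ , eq″ | no c≢ =
        ℕ.1+n≢0 (ℕ.suc-injective (inj (2 ℕ.+ c) 1 (s≤s (s≤s (s≤s c≤))) (s≤s (s≤s z≤n))
          (trans eq″ (trans (cong (ι i) s″≡) eq))))
        where
        same : s′ i ≡ s i
        same = vertex⁻ Tf′ (Equivalence.from (mem′ _) (0 , s≤s z≤n , sym eq))
        s″≡ : s″ i ≡ s i
        s″≡ = trans (sym (vertex⁻ Tf′ (Equivalence.from (mem′ _) (suc c , s≤s (ℕ.≤∧≢⇒< c≤ c≢) , eq″)))) same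

-- The incidence hypergraph and the size of a colour class

module IncidenceHypergraph where

  open import Defs
  open import Data.Nat as ℕ using (ℕ; zero; suc)
  import Data.Nat.Properties as ℕ
  import Data.Nat.Divisibility as ℕ
  open import Data.Nat.Primality using (Prime; prime⇒nonZero)
  open import Data.Integer as ℤ using (ℤ; +_; _+_; _*_; _-_; -_; 0ℤ; 1ℤ; -1ℤ)
  import Data.Integer.Properties as ℤ
  open import Data.Integer.Divisibility.Signed using (∣⇒∣ᵤ)
  open import Data.Integer.Tactic.RingSolver using (solve-∀)
  open import Data.Fin as Fin using (Fin; zero; suc; toℕ; fromℕ<; combine; remQuot; finToFun; funToFin; inject≤; join)
  import Data.Fin.Properties as Fin
  open import Data.Fin.Subset using (Subset; ∣_∣)
  open import Data.List using (List; tabulate; filter; length)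
  open import Data.List.Relation.Unary.All.Properties using (tabulate⁺)
  open import Data.List.Relation.Unary.Any using (index)
  import Data.List.Relation.Unary.Unique.Propositional.Properties as Unique
  open import Data.List.Membership.Propositional using () renaming (_∈_ to _∈ₗ_)
  open import Data.List.Membership.Propositional.Properties using (∈-tabulate⁺; ∈-tabulate⁻; ∈-filter⁺)
  open import Data.List.Membership.Setoid.Properties using (index-injective)
  open import Data.Sum.Properties using (inj₁-injective; inj₂-injective)
  open import Function using (_∘_; case_of_)
  open AffinePlane
  open ZeroOneMatrix
  open TransversalEdges

  combine-injective₂ : ∀ {m n} {i k : Fin m} {j l : Fin n} → combine i j ≡ combine k l → i ≡ k × j ≡ l
  combine-injective₂ {i = i} {k} {j} {l} = Fin.combine-injective i j k l

  remQuot-injective : ∀ {m} n {i j : Fin (m ℕ.* n)} → proj₁ (remQuot {m} n i) ≡ proj₁ (remQuot {m} n j) →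
                      proj₂ (remQuot {m} n i) ≡ proj₂ (remQuot {m} n j) → i ≡ j
  remQuot-injective {m} n {i} {j} e₁ e₂ =
    trans (sym (Fin.combine-remQuot {m} n i)) (trans (cong₂ combine e₁ e₂) (Fin.combine-remQuot {m} n j))

  funToFin-cong : ∀ {m n} {f g : Fin m → Fin n} → (∀ j → f j ≡ g j) → funToFin f ≡ funToFin g
  funToFin-cong {zero} h = refl
  funToFin-cong {suc m} h = cong₂ combine (h zero) (funToFin-cong (h ∘ suc))

  funToFin-injective : ∀ {m n} {f g : Fin m → Fin n} → funToFin f ≡ funToFin g → ∀ j → f j ≡ g j
  funToFin-injective {f = f} {g} eq j =
    trans (sym (Fin.finToFun-funToFin f j)) (trans (cong (λ c → finToFun c j) eq) (Fin.finToFun-funToFin g j))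

  finToFun-injective : ∀ {m n} {i j : Fin (n ℕ.^ m)} → (∀ l → finToFun {n} {m} i l ≡ finToFun j l) → i ≡ j
  finToFun-injective {m} {n} {i} {j} h =
    trans (sym (Fin.funToFin-finToFin {m} {n} i)) (trans (funToFin-cong h) (Fin.funToFin-finToFin {m} {n} j))

  module Residues {p : ℕ} (pr : Prime p) where
    open Modular pr

    opaque
      ⟦_⟧ : Fin p → ℤ
      ⟦ i ⟧ = + toℕ i

      ⟦⟧-injective : ∀ i j → ⟦ i ⟧ ≈ ⟦ j ⟧ → i ≡ j
      ⟦⟧-injective i j h = Fin.toℕ-injective (ℤ.+-injective (ℤ.i-j≡0⇒i≡j (+ toℕ i) (+ toℕ j) (ℤ.∣i∣≡0⇒i≡0 {+ toℕ i - + toℕ j} zero-abs)))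
        where
        d : ℕ
        d = ℤ.∣ + toℕ i - + toℕ j ∣
        d<p : d ℕ.< p
        d<p = ℕ.≤-<-trans (subst (ℕ._≤ (toℕ i ℕ.⊔ toℕ j)) (cong ℤ.∣_∣ (sym (ℤ.m-n≡m⊖n (toℕ i) (toℕ j)))) (ℤ.∣m⊝n∣≤m⊔n (toℕ i) (toℕ j)))
                          (ℕ.⊔-lub (Fin.toℕ<n i) (Fin.toℕ<n j))
        small : ∀ d → d ℕ.< p → p ℕ.∣ d → d ≡ 0
        small zero _ _ = refl
        small (suc d) lt dv = ⊥-elim (ℕ.<⇒≱ lt (ℕ.∣⇒≤ dv))
        zero-abs : d ≡ 0
        zero-abs = small d d<p (∣⇒∣ᵤ h)

      representative : ∀ a → ∃[ i ] a ≈ ⟦ i ⟧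
      representative a = let r , r<p , eq = residue a in
        fromℕ< r<p , subst (λ s → a ≈ + s) (sym (Fin.toℕ-fromℕ< r<p)) eq

  module Construction {p : ℕ} (pr : Prime p) (b m n : ℕ)
    (fits : suc (suc m) ℕ.* (p ℕ.* (p ℕ.* b)) ℕ.≤ n) where

    open Modular pr
    open Residues pr

    -- Each part has W vertices; a vertex is combine Y (combine X copy).  M is the number
    -- of edges: the tuple is free except for the Y of its first entry.
    V W M : ℕ
    V = p ℕ.* b
    W = p ℕ.* V
    M = V ℕ.* W ℕ.^ suc m

    ι : Fin (suc (suc m)) → Fin W → Fin n
    ι j w = inject≤ (combine j w) fits

    ι-injective : ∀ {i j a c} → ι i a ≡ ι j c → i ≡ j × a ≡ c
    ι-injective eq = combine-injective₂ (Fin.inject≤-injective fits fits _ _ eq)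

    open Transversals {n} {m} {W} ι ι-injective

    Y : Fin W → Fin p
    Y w = proj₁ (remQuot {p} V w)

    tag : Fin W → Fin V
    tag w = proj₂ (remQuot {p} V w)

    X : Fin W → Fin p
    X w = proj₁ (remQuot {p} b (tag w))

    copy : Fin W → Fin b
    copy w = proj₂ (remQuot {p} b (tag w))

    sumY : ∀ {r} → (Fin r → Fin W) → ℤ
    sumY {zero} f = 0ℤ
    sumY {suc r} f = ⟦ Y (f zero) ⟧ + sumY (f ∘ suc)

    sumY-cong : ∀ {r} {f g : Fin r → Fin W} → (∀ j → Y (f j) ≡ Y (g j)) → sumY f ≡ sumY g
    sumY-cong {zero} h = refl
    sumY-cong {suc r} h = cong₂ (λ i s → ⟦ i ⟧ + s) (h zero) (sumY-cong (h ∘ suc))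

    sumY-differ : ∀ {r} {f g : Fin r → Fin W} j → (∀ i → i ≢ j → f i ≡ g i) →
                  sumY f - sumY g ≡ ⟦ Y (f j) ⟧ - ⟦ Y (g j) ⟧
    sumY-differ {suc r} {f} {g} zero same = begin
      (⟦ Y (f zero) ⟧ + sumY (f ∘ suc)) - (⟦ Y (g zero) ⟧ + sumY (g ∘ suc))
        ≡⟨ cong (λ s → (⟦ Y (f zero) ⟧ + s) - (⟦ Y (g zero) ⟧ + sumY (g ∘ suc))) (sumY-cong (λ j → cong Y (same (suc j) λ ()))) ⟩
      (⟦ Y (f zero) ⟧ + sumY (g ∘ suc)) - (⟦ Y (g zero) ⟧ + sumY (g ∘ suc))
        ≡⟨ alg ⟦ Y (f zero) ⟧ ⟦ Y (g zero) ⟧ (sumY (g ∘ suc)) ⟩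
      ⟦ Y (f zero) ⟧ - ⟦ Y (g zero) ⟧ ∎
      where
      open ≡-Reasoning
      alg : ∀ a b s → (a + s) - (b + s) ≡ a - b
      alg = solve-∀
    sumY-differ {suc r} {f} {g} (suc j) same = begin
      (⟦ Y (f zero) ⟧ + sumY (f ∘ suc)) - (⟦ Y (g zero) ⟧ + sumY (g ∘ suc))
        ≡⟨ cong (λ w → (⟦ Y w ⟧ + sumY (f ∘ suc)) - (⟦ Y (g zero) ⟧ + sumY (g ∘ suc))) (same zero λ ()) ⟩
      (⟦ Y (g zero) ⟧ + sumY (f ∘ suc)) - (⟦ Y (g zero) ⟧ + sumY (g ∘ suc))
        ≡⟨ alg ⟦ Y (g zero) ⟧ (sumY (f ∘ suc)) (sumY (g ∘ suc)) ⟩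
      sumY (f ∘ suc) - sumY (g ∘ suc)
        ≡⟨ sumY-differ j (λ i i≢j → same (suc i) (i≢j ∘ Fin.suc-injective)) ⟩
      ⟦ Y (f (suc j)) ⟧ - ⟦ Y (g (suc j)) ⟧ ∎
      where
      open ≡-Reasoning
      alg : ∀ s a b → (s + a) - (s + b) ≡ a - b
      alg = solve-∀

    freeTag : Fin M → Fin V
    freeTag i = proj₁ (remQuot {V} (W ℕ.^ suc m) i)

    rest : Fin M → Fin (suc m) → Fin W
    rest i = finToFun {W} {suc m} (proj₂ (remQuot {V} (W ℕ.^ suc m) i))

    firstX : Fin V → Fin p
    firstX q = proj₁ (remQuot {p} b q)

    forced : ∀ i → ∃[ y ] (⟦ firstX (freeTag i) ⟧ * ⟦ X (rest i zero) ⟧ - sumY (rest i) ≈ ⟦ y ⟧)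
    forced i = representative (⟦ firstX (freeTag i) ⟧ * ⟦ X (rest i zero) ⟧ - sumY (rest i))

    tuple : Fin M → Fin (suc (suc m)) → Fin W
    tuple i zero = combine (proj₁ (forced i)) (freeTag i)
    tuple i (suc j) = rest i j

    tag-first : ∀ i → tag (tuple i zero) ≡ freeTag i
    tag-first i = cong proj₂ (Fin.remQuot-combine {p} {V} (proj₁ (forced i)) (freeTag i))

    Y-first : ∀ i → Y (tuple i zero) ≡ proj₁ (forced i)
    Y-first i = cong proj₁ (Fin.remQuot-combine {p} {V} (proj₁ (forced i)) (freeTag i))

    tuple-equation : ∀ i → ⟦ X (tuple i zero) ⟧ * ⟦ X (rest i zero) ⟧ ≈ ⟦ Y (tuple i zero) ⟧ + sumY (rest i)
    tuple-equation i = subst₂ (λ a c → ⟦ a ⟧ * ⟦ X (rest i zero) ⟧ ≈ ⟦ c ⟧ + sumY (rest i))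
      (cong firstX (sym (tag-first i))) (sym (Y-first i))
      (Null-resp (alg (⟦ firstX (freeTag i) ⟧ * ⟦ X (rest i zero) ⟧) (sumY (rest i)) ⟦ proj₁ (forced i) ⟧) (proj₂ (forced i)))
      where
      alg : ∀ a s c → a - (c + s) ≡ a - s - c
      alg = solve-∀

    tuple-injective : ∀ {i j} → (∀ l → tuple i l ≡ tuple j l) → i ≡ j
    tuple-injective {i} {j} h = remQuot-injective {V} (W ℕ.^ suc m)
      (trans (sym (tag-first i)) (trans (cong tag (h zero)) (tag-first j)))
      (finToFun-injective {suc m} {W} (h ∘ suc))

    edge : Fin M → Subset n
    edge i = transversal (tuple i)

    edge-injective : ∀ {i j} → edge i ≡ edge j → i ≡ j
    edge-injective {i} {j} eq = tuple-injective (transversal-injective (tuple i) (tuple j) eq)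

    G : Hypergraph (suc (suc m)) n
    G = record
      { edges = tabulate edge
      ; unique = Unique.tabulate⁺ edge-injective
      ; uniform = tabulate⁺ (λ i → ∣transversal∣ (tuple i))
      }

    -- Room for the codes of one class: 4p labels of (X₀ , X₁), the copies of the first two entries,
    -- the tags of the other m. No factor is spent on the Y, and the value is 4 M / p^k.
    B : ℕ
    B = 4 ℕ.* (p ℕ.* (b ℕ.* (b ℕ.* V ℕ.^ m)))

    module Part {ℓ : ℕ} (col : Subset n → Fin (suc ℓ)) (c : Fin (suc ℓ))
      (diam : DiamAtMost (suc (suc m)) (InPart G col c) 3) where

      Member : Set
      Member = Σ[ i ∈ Fin M ] col (edge i) ≡ c

      tup : Member → Fin (suc (suc m)) → Fin W
      tup (i , _) = tuple i

      member-of : ∀ {e} → InPart G col c e → ∃[ q ] e ≡ edge (proj₁ {B = λ i → col (edge i) ≡ c} q)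
      member-of (e∈ , ce) with ∈-tabulate⁻ {f = edge} e∈
      ... | i , refl = (i , ce) , refl

      inPart : ∀ q → InPart G col c (edge (proj₁ {B = λ i → col (edge i) ≡ c} q))
      inPart (i , ci) = ∈-tabulate⁺ {f = edge} i , ci

      swap-at : ∀ q q′ j → tup q j ≢ tup q′ j → ∃[ r ] ∃[ r′ ]
        (tup r j ≡ tup q j × tup r′ j ≡ tup q′ j × (∀ i → i ≢ j → tup r i ≡ tup r′ i))
      swap-at q q′ j ne =
        let f , f′ , s , s′ , Pf , Pf′ , Tf , Tf′ , sj , s′j , same =
              exchange {InPart G col c} transP diam (inPart q) (transversal-isTransversal (tup q))
                (inPart q′) (transversal-isTransversal (tup q′)) j ne
            r , f≡ = member-of Pf
            r′ , f′≡ = member-of Pf′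
            rs = λ i → tup-unique {f} {s} r f≡ Tf i
            rs′ = λ i → tup-unique {f′} {s′} r′ f′≡ Tf′ i
        in r , r′ , trans (rs j) sj , trans (rs′ j) s′j , λ i i≢j → trans (rs i) (trans (same i i≢j) (sym (rs′ i)))
        where
        transP : ∀ {e} → InPart G col c e → ∃[ t ] IsTransversal e t
        transP P with member-of P
        ... | q , refl = tup q , transversal-isTransversal (tup q)
        tup-unique : ∀ {e s} q → e ≡ edge (proj₁ {B = λ i → col (edge i) ≡ c} q) → IsTransversal e s → ∀ i → tup q i ≡ s i
        tup-unique {s = s} q refl T i = sym (vertex⁻ T (vertex (transversal-isTransversal (tup q)) i))

      second : Fin (suc (suc m))
      second = suc zero

      -- A member stands both for a point, its entry 0, and for a line, whose slope comes from entry
      -- 1 and whose constant term comes from all entries after the first. The equation of the edge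
      -- says that its point lies on its line.
      x y z w tail : Member → ℤ
      x q = ⟦ X (tup q zero) ⟧
      y q = ⟦ Y (tup q zero) ⟧
      z q = ⟦ X (tup q second) ⟧
      w q = sumY (tup q ∘ suc)
      tail q = sumY {m} (λ j → tup q (suc (suc j)))

      equation : ∀ q → x q * z q ≈ y q + w q
      equation (i , _) = tuple-equation i

      -- Two members that differ in this entry only have equations with the same product and the
      -- same other summands, so their Y agree modulo p.
      Y-constant : ∀ q q′ j → Y (tup q (suc (suc j))) ≡ Y (tup q′ (suc (suc j)))
      Y-constant q q′ j with tup q (suc (suc j)) Fin.≟ tup q′ (suc (suc j))
      ... | yes eq = cong Y eq
      ... | no ne =
        let r , r′ , rj , r′j , same = swap-at q q′ (suc (suc j)) ne
            eq′ : x r * z r ≈ y r + w r′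
            eq′ = subst₂ (λ u v → ⟦ X u ⟧ * ⟦ X v ⟧ ≈ ⟦ Y u ⟧ + w r′) (sym (same zero λ ())) (sym (same second λ ())) (equation r′)
            differ = sumY-differ {f = tup r ∘ suc} {tup r′ ∘ suc} (suc j) (λ i i≢ → same (suc i) (i≢ ∘ Fin.suc-injective))
            null : w r ≈ w r′
            null = Null-resp (alg (x r * z r) (y r) (w r) (w r′)) (null-comb₂ -1ℤ 1ℤ (equation r) eq′)
        in subst₂ (λ u v → Y u ≡ Y v) rj r′j (⟦⟧-injective _ _ (subst Null differ null))
        where
        alg : ∀ a y w w′ → w - w′ ≡ -1ℤ * (a - (y + w)) + 1ℤ * (a - (y + w′))
        alg = solve-∀

      tail-constant : ∀ q q′ → tail q ≡ tail q′
      tail-constant q q′ = sumY-cong (Y-constant q q′)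

      -- The exchanged edges share every entry but the first, hence define one line, and their
      -- points are those of a and a′.
      joining : ∀ a a′ → tup a zero ≢ tup a′ zero → ∃[ l ] (x a * z l ≈ y a + w l × x a′ * z l ≈ y a′ + w l)
      joining a a′ ne =
        let r , r′ , r0 , r′0 , same = swap-at a a′ zero ne
        in r , subst (λ v → ⟦ X v ⟧ * z r ≈ ⟦ Y v ⟧ + w r) r0 (equation r)
             , subst₂ (λ v s → x a′ * ⟦ X v ⟧ ≈ y a′ + s) (sym (same second λ ())) (sym (sumY-cong λ j → cong Y (same (suc j) λ ())))
                 (subst (λ v → ⟦ X v ⟧ * z r′ ≈ ⟦ Y v ⟧ + w r′) r′0 (equation r′))

      -- The exchanged edges share their point. Their lines are those of l and l′ because entry 1
      -- agrees and the tail is constant on the class.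
      meeting : ∀ l l′ → tup l second ≢ tup l′ second → ∃[ a ] (x a * z l ≈ y a + w l × x a * z l′ ≈ y a + w l′)
      meeting l l′ ne =
        let r , r′ , r1 , r′1 , same = swap-at l l′ second ne
        in r , subst₂ (λ v s → x r * ⟦ X v ⟧ ≈ y r + (⟦ Y v ⟧ + s)) r1 (tail-constant r l) (equation r)
             , subst (λ u → ⟦ X u ⟧ * z l′ ≈ ⟦ Y u ⟧ + w l′) (sym (same zero λ ()))
                 (subst₂ (λ v s → x r′ * ⟦ X v ⟧ ≈ y r′ + (⟦ Y v ⟧ + s)) r′1 (tail-constant r′ l′) (equation r′))

      -- Distinct vertices of part 0 are joined by a non-vertical line, on which x determines y.
      -- Dually, in `w-cong`, lines of equal slope that meet coincide.
      y-cong : ∀ a a′ → x a ≈ x a′ → y a ≈ y a′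
      y-cong a a′ e with tup a zero Fin.≟ tup a′ zero
      ... | yes eq = ≈-reflexive (y a) (y a′) (cong (λ v → ⟦ Y v ⟧) eq)
      ... | no ne =
        let l , h , h′ = joining a a′ ne
        in Null-resp (alg (x a) (x a′) (z l) (y a) (y a′) (w l)) (null-comb₃ -1ℤ 1ℤ (z l) h h′ e)
        where
        alg : ∀ x x′ z y y′ w → y - y′ ≡ -1ℤ * (x * z - (y + w)) + 1ℤ * (x′ * z - (y′ + w)) + z * (x - x′)
        alg = solve-∀

      w-cong : ∀ l l′ → z l ≈ z l′ → w l ≈ w l′
      w-cong l l′ e with tup l second Fin.≟ tup l′ second
      ... | yes eq = ≈-reflexive (w l) (w l′) (cong₂ (λ v s → ⟦ Y v ⟧ + s) eq (tail-constant l l′))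
      ... | no ne =
        let a , h , h′ = meeting l l′ ne
        in Null-resp (alg (x a) (z l) (z l′) (y a) (w l) (w l′)) (null-comb₃ -1ℤ 1ℤ (x a) h h′ e)
        where
        alg : ∀ x z z′ y w w′ → w - w′ ≡ -1ℤ * (x * z - (y + w)) + 1ℤ * (x * z′ - (y + w′)) + x * (z - z′)
        alg = solve-∀

      open Plane {Member} {Member} x y z w y-cong w-cong

      join-line : ∀ a a′ → ¬ x a ≈ x a′ → ∃[ l ] (a on l × a′ on l)
      join-line a a′ ne = let l , h , h′ = joining a a′ (λ eq → ne (≈-reflexive (x a) (x a′) (cong (λ v → ⟦ X v ⟧) eq)))
                          in l , incident h , incident h′

      meet-point : ∀ l l′ → ¬ z l ≈ z l′ → ∃[ a ] (a on l × a on l′)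
      meet-point l l′ ne = let a , h , h′ = meeting l l′ (λ eq → ne (≈-reflexive (z l) (z l′) (cong (λ v → ⟦ X v ⟧) eq)))
                           in a , incident h , incident h′

      open Closed join-line meet-point

      D : Fin p → Fin p → Set
      D u v = Σ[ i ∈ Fin M ] (col (edge i) ≡ c × X (tuple i zero) ≡ u × X (tuple i second) ≡ v)

      D? : ∀ u v → Dec (D u v)
      D? u v = Fin.any? λ i → (col (edge i) Fin.≟ c) ×-dec ((X (tuple i zero) Fin.≟ u) ×-dec (X (tuple i second) Fin.≟ v))

      open Labelling D D?

      forbidden : Forbidden
      forbidden {u} {u₁} {u₂} {u₃} {v} {v′} {v″} u₁≢u u₂≢u u₁≢u₂ u₃≢u v≢v′ v≢v″ v′≢v″ d d′ d″ d₁ d₂ d₃ =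
        -- L and M are the columns v′ and v″; N is the column v, represented by F itself, now read
        -- as a line.
        no-pencil F {q d′} {q d″} {F} {q d₁} {q d₂} {q d₃}
          (record { FL = column d d′ ; FM = column d d″ ; FN = incident (equation F)
                  ; LM = z-apart d′ d″ v′≢v″ ; LN = z-apart d′ d (≢-sym v≢v′) ; MN = z-apart d″ d (≢-sym v≢v″) })
          (row d₁ d) (row d₂ d) (x-apart d₁ d u₁≢u) (x-apart d₂ d u₂≢u) (x-apart d₁ d₂ u₁≢u₂)
          (row d₃ d′) (x-apart d₃ d u₃≢u)
        where
        q : ∀ {u v} → D u v → Member
        q (i , ci , _) = i , ci
        F = q d
        column : ∀ {u v v′} (d : D u v) (d′ : D u v′) → q d on q d′
        column d@(_ , _ , e , _) d′@(_ , _ , e′ , _) =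
          on-resp-pt {q d′} {q d} {q d′} (≈-reflexive (x (q d′)) (x (q d)) (cong ⟦_⟧ (trans e′ (sym e)))) (incident (equation (q d′)))
        row : ∀ {u u′ v} (d : D u v) (d′ : D u′ v) → q d on q d′
        row d@(_ , _ , _ , e) d′@(_ , _ , _ , e′) =
          on-resp-ln {q d} {q d} {q d′} (≈-reflexive (z (q d)) (z (q d′)) (cong ⟦_⟧ (trans e (sym e′)))) (incident (equation (q d)))
        z-apart : ∀ {u v u′ v′} (d : D u v) (d′ : D u′ v′) → v ≢ v′ → ¬ z (q d) ≈ z (q d′)
        z-apart (_ , _ , _ , e) (_ , _ , _ , e′) ne h = ne (trans (sym e) (trans (⟦⟧-injective _ _ h) e′))
        x-apart : ∀ {u v u′ v′} (d : D u v) (d′ : D u′ v′) → u ≢ u′ → ¬ x (q d) ≈ x (q d′)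
        x-apart (_ , _ , e , _) (_ , _ , e′ , _) ne h = ne (trans (sym e) (trans (⟦⟧-injective _ _ h) e′))

      labelOf : ∀ q → ∃ (Label (X (tup q zero)) (X (tup q second)))
      labelOf q = label (X (tup q zero)) (X (tup q second))

      code : Member → Fin B
      code q = combine (proj₁ (proj₁ (labelOf q))) (combine (proj₂ (proj₁ (labelOf q)))
        (combine (copy (tup q zero)) (combine (copy (tup q second)) (funToFin (λ j → tag (tup q (suc (suc j))))))))

      -- The label returns X₀ and X₁, from which `y-cong` and `w-cong` recover Y₀ and Y₁; the other
      -- Y are constant on the class, and copies and tags stand in the code.
      code-injective : ∀ q q′ → code q ≡ code q′ → proj₁ q ≡ proj₁ q′
      code-injective q@(i , ci) q′@(i′ , ci′) eq =
        let e₁ , eq₁ = combine-injective₂ eq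
            e₂ , eq₂ = combine-injective₂ eq₁
            e₃ , eq₃ = combine-injective₂ eq₂
            e₄ , eq₄ = combine-injective₂ eq₃
            e₅ = funToFin-injective eq₄
            X₀ , X₁ = label-injective forbidden (i , ci , refl , refl) (i′ , ci′ , refl , refl)
                        (subst (Label _ _) (cong₂ _,_ e₁ e₂) (proj₂ (labelOf q))) (proj₂ (labelOf q′))
            Y₀ = ⟦⟧-injective _ _ (y-cong q q′ (≈-reflexive (x q) (x q′) (cong ⟦_⟧ X₀)))
            Y₁ = ⟦⟧-injective _ _ (Null-resp (alg ⟦ Y (tup q second) ⟧ ⟦ Y (tup q′ second) ⟧ (tail q))
                   (subst (λ s → ⟦ Y (tup q second) ⟧ + tail q ≈ ⟦ Y (tup q′ second) ⟧ + s) (sym (tail-constant q q′))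
                     (w-cong q q′ (≈-reflexive (z q) (z q′) (cong ⟦_⟧ X₁)))))
        in tuple-injective λ
          { zero → remQuot-injective {p} V Y₀ (remQuot-injective {p} b X₀ e₃)
          ; (suc zero) → remQuot-injective {p} V Y₁ (remQuot-injective {p} b X₁ e₄)
          ; (suc (suc j)) → remQuot-injective {p} V (Y-constant q q′ j) (e₅ j) }
        where
        alg : ∀ a c s → a - c ≡ (a + s) - (c + s)
        alg = solve-∀

    -- All edges are injected: those of colour 0 into the positions of `E₀`, the others into pairs
    -- of a colour and a code.
    partition-bound : ∀ {ℓ} (col : Subset n → Fin (suc ℓ)) →
      (∀ c → DiamAtMost (suc (suc m)) (InPart G col (suc c)) 3) → M ℕ.≤ sizeE₀ G col ℕ.+ ℓ ℕ.* B
    partition-bound {ℓ} col diam = Fin.injective⇒≤ {f = λ i → encode i (split (col (edge i)) refl)} λ {i} {j} →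
        encode-injective i j (split (col (edge i)) refl) (split (col (edge j)) refl)
      where
      Status : Fin M → Set
      Status i = col (edge i) ≡ zero ⊎ ∃[ c ] col (edge i) ≡ suc c

      split : ∀ {i} (c : Fin (suc ℓ)) → col (edge i) ≡ c → Status i
      split zero eq = inj₁ eq
      split (suc c) eq = inj₂ (c , eq)

      E₀ = filter (λ e → col e Fin.≟ zero) (tabulate edge)

      inE₀ : ∀ i → col (edge i) ≡ zero → edge i ∈ₗ E₀
      inE₀ i eq = ∈-filter⁺ (λ e → col e Fin.≟ zero) (∈-tabulate⁺ {f = edge} i) eq

      encode : ∀ i → Status i → Fin (length E₀ ℕ.+ ℓ ℕ.* B)
      encode i (inj₁ eq) = join (length E₀) (ℓ ℕ.* B) (inj₁ (index (inE₀ i eq)))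
      encode i (inj₂ (c , eq)) = join (length E₀) (ℓ ℕ.* B) (inj₂ (combine c (Part.code col (suc c) (diam c) (i , eq))))

      join-injective : ∀ {u v} → join (length E₀) (ℓ ℕ.* B) u ≡ join (length E₀) (ℓ ℕ.* B) v → u ≡ v
      join-injective {u} {v} eq = trans (sym (Fin.splitAt-join (length E₀) (ℓ ℕ.* B) u))
        (trans (cong (Fin.splitAt (length E₀)) eq) (Fin.splitAt-join (length E₀) (ℓ ℕ.* B) v))

      encode-injective : ∀ i j si sj → encode i si ≡ encode j sj → i ≡ j
      encode-injective i j (inj₁ ei) (inj₁ ej) eq =
        edge-injective (index-injective (setoid _) (inE₀ i ei) (inE₀ j ej) (inj₁-injective (join-injective {inj₁ _} {inj₁ _} eq)))
      encode-injective i j (inj₁ ei) (inj₂ ej) eq = case join-injective {inj₁ _} {inj₂ _} eq of λ ()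
      encode-injective i j (inj₂ ei) (inj₁ ej) eq = case join-injective {inj₂ _} {inj₁ _} eq of λ ()
      encode-injective i j (inj₂ (c , ei)) (inj₂ (c′ , ej)) eq =
        let same , eq′ = combine-injective₂ {ℓ} {B} (inj₂-injective (join-injective {inj₂ _} {inj₂ _} eq))
        in within-part same ei ej eq′
        where
        within-part : ∀ {c c′} → c ≡ c′ → (ei : col (edge i) ≡ suc c) (ej : col (edge j) ≡ suc c′) →
                      Part.code col (suc c) (diam c) (i , ei) ≡ Part.code col (suc c′) (diam c′) (j , ej) → i ≡ j
        within-part {c} refl ei ej = Part.code-injective col (suc c) (diam c) (i , ei) (j , ej)

-- Choice of the prime and the blow-up; counting colours

module NaturalBounds where

  open import Data.Nat
  open import Data.Nat.Properties
  open import Data.Nat.DivMod using (_/_; _%_; m/n*n≤m; m≡m%n+[m/n]*n; m%n<n; /-monoˡ-≤; m*n/n≡m)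
  open import Data.Nat.Primality using (Prime)
  open import Data.Nat.Tactic.RingSolver using (solve-∀)
  open PrimeGap

  *-^-distrib : ∀ x y k → (x * y) ^ k ≡ x ^ k * y ^ k
  *-^-distrib x y zero = refl
  *-^-distrib x y (suc k) = trans (cong (x * y *_) (*-^-distrib x y k)) (alg x y (x ^ k) (y ^ k))
    where
    alg : ∀ x y u v → x * y * (u * v) ≡ x * u * (y * v)
    alg = solve-∀

  m<[1+m/n]*n : ∀ m n .{{_ : NonZero n}} → m < suc (m / n) * n
  m<[1+m/n]*n m n = subst (_< n + m / n * n) (sym (m≡m%n+[m/n]*n m n)) (+-monoˡ-< (m / n * n) (m%n<n m n))

  power-of-4-below : ∀ r → ∃[ e ] (2 ^ (2 * e) ≤ suc r × suc r < 2 ^ (2 * suc e))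
  power-of-4-below zero = 0 , ≤-refl , s≤s (s≤s z≤n)
  power-of-4-below (suc r) with power-of-4-below r
  ... | e , lo , hi with suc (suc r) <? 2 ^ (2 * suc e)
  ...   | yes lt = e , m≤n⇒m≤1+n lo , lt
  ...   | no ge = suc e , ≮⇒≥ ge , ≤-<-trans hi (^-monoʳ-< 2 (s≤s (s≤s z≤n)) (*-monoʳ-< 2 (n<1+n (suc e))))

  -- If the integer quotient R of d by D satisfies 4^e ≤ R < 4^(e+1), a prime in (4^(e-2) , 4^e] is
  -- at most R and falls short of it by a factor of at most 4^3 = 64. The bound 256 = 4^4 forces e ≥
  -- 4, as `prime-between` requires.
  prime-near-quotient : ∀ D d → .{{NonZero D}} → 256 * D ≤ d → ∃[ p ] (Prime p × p * D ≤ d × d ≤ 64 * p * D)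
  prime-near-quotient D d le = from-power (power-of-4-below (pred R))
    where
    open ≤-Reasoning
    R = d / D
    256≤R : 256 ≤ R
    256≤R = subst (_≤ R) (m*n/n≡m 256 D) (/-monoˡ-≤ D le)
    R≡ : suc (pred R) ≡ R
    R≡ = suc-pred R {{>-nonZero (≤-trans (s≤s z≤n) 256≤R)}}
    from-power : ∃[ e ] (2 ^ (2 * e) ≤ suc (pred R) × suc (pred R) < 2 ^ (2 * suc e)) →
                 ∃[ p ] (Prime p × p * D ≤ d × d ≤ 64 * p * D)
    from-power (e , lo , hi) = p , pr , upper , lower
      where
      4≤e : 4 ≤ e
      4≤e = ≮⇒≥ λ { (s≤s e≤3) → <⇒≱ (<-≤-trans (subst (_< 2 ^ (2 * suc e)) R≡ hi) (^-monoʳ-≤ 2 (*-monoʳ-≤ 2 (s≤s e≤3)))) 256≤R }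
      b = e ∸ 2
      b+2≡e : b + 2 ≡ e
      b+2≡e = m∸n+n≡m (≤-trans (s≤s (s≤s z≤n)) 4≤e)
      found = prime-between b (∸-monoˡ-≤ 2 4≤e)
      p = proj₁ found
      pr = proj₁ (proj₂ found)
      p> = proj₁ (proj₂ (proj₂ found))
      p≤ = proj₂ (proj₂ (proj₂ found))
      upper : p * D ≤ d
      upper = begin
        p * D ≤⟨ *-monoˡ-≤ D (≤-trans p≤ (subst (λ u → 2 ^ (2 * u) ≤ R) (sym b+2≡e) (subst (2 ^ (2 * e) ≤_) R≡ lo))) ⟩
        R * D ≤⟨ m/n*n≤m d D ⟩
        d ∎
      exponent : ∀ b → 2 * suc (b + 2) ≡ 6 + 2 * b
      exponent = solve-∀
      lower : d ≤ 64 * p * D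
      lower = begin
        d             ≤⟨ <⇒≤ (m<[1+m/n]*n d D) ⟩
        suc R * D     ≤⟨ *-monoˡ-≤ D (begin
          suc R             ≡⟨ cong suc R≡ ⟨
          suc (suc (pred R)) ≤⟨ hi ⟩
          2 ^ (2 * suc e)   ≡⟨ cong (λ u → 2 ^ (2 * suc u)) b+2≡e ⟨
          2 ^ (2 * suc (b + 2)) ≡⟨ cong (2 ^_) (exponent b) ⟩
          2 ^ (6 + 2 * b)   ≡⟨ ^-distribˡ-+-* 2 6 (2 * b) ⟩
          64 * 2 ^ (2 * b)  ≤⟨ *-monoʳ-≤ 64 (<⇒≤ p>) ⟩
          64 * p            ∎) ⟩
        64 * p * D ∎

  blocks : ∀ K n → .{{_ : NonZero K}} → K ≤ n → ∃[ b ] (1 ≤ b × b * K ≤ n × n ≤ 2 * (b * K))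
  blocks K n K≤n = b , 1≤b , m/n*n≤m n K , (begin
    n              ≤⟨ <⇒≤ (m<[1+m/n]*n n K) ⟩
    K + b * K      ≤⟨ +-monoˡ-≤ (b * K) (subst (_≤ b * K) (*-identityˡ K) (*-monoˡ-≤ K 1≤b)) ⟩
    b * K + b * K  ≡⟨ cong (b * K +_) (+-identityʳ (b * K)) ⟨
    2 * (b * K)    ∎)
    where
    open ≤-Reasoning
    b = n / K
    1≤b : 1 ≤ b
    1≤b = subst (_≤ b) (m*n/n≡m 1 K) (/-monoˡ-≤ K (≤-trans (≤-reflexive (*-identityˡ K)) K≤n))

  module Arithmetic (m : ℕ) where

    -- As n ≤ 2 k W and p M = W^k, a set of at most ε n^k edges has at most ε (2k)^k p M elements; p
    -- D ≤ 1/ε makes this at most M / 2.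
    k D : ℕ
    k = suc (suc m)
    D = 2 * (2 * k) ^ k

    instance
      D≢0 : NonZero D
      D≢0 = m*n≢0 2 _ {{_}} {{m^n≢0 (2 * k) k}}

    k≤D : k ≤ D
    k≤D = begin
      k               ≤⟨ m≤m+n k (k + 0) ⟩
      2 * k           ≡⟨ ^-identityʳ (2 * k) ⟨
      (2 * k) ^ 1     ≤⟨ ^-monoʳ-≤ (2 * k) {1} {k} (s≤s z≤n) ⟩
      (2 * k) ^ k     ≤⟨ m≤m+n _ _ ⟩
      D ∎
      where open ≤-Reasoning

    -- With ε = a / d the hypotheses say p D ≤ 1/ε and 1/ε² ≤ n, so p² D² ≤ n, and k ≤ D². Here the
    -- lower bound on ε makes the k parts of p² vertices fit.
    room : ∀ p a d n → 1 ≤ a → p * (D * a) ≤ d → d * d ≤ a * a * n → k * (p * p) ≤ n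
    room p a@(suc _) d n _ pDa≤d dd≤ = *-cancelˡ-≤ (a * a) (begin
      a * a * (k * (p * p))   ≤⟨ *-monoʳ-≤ (a * a) (*-monoˡ-≤ (p * p) (≤-trans k≤D (m≤m*n D D))) ⟩
      a * a * (D * D * (p * p)) ≡⟨ alg a D p ⟩
      p * (D * a) * (p * (D * a)) ≤⟨ *-mono-≤ pDa≤d pDa≤d ⟩
      d * d                   ≤⟨ dd≤ ⟩
      a * a * n ∎)
      where
      open ≤-Reasoning
      alg : ∀ a D p → a * a * (D * D * (p * p)) ≡ p * (D * a) * (p * (D * a))
      alg = solve-∀

    module Count (p b : ℕ) where
      V W M B : ℕ
      V = p * b
      W = p * V
      M = V * W ^ suc m
      B = 4 * (p * (b * (b * V ^ m)))

      B*p^k : B * p ^ k ≡ 4 * M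
      B*p^k = begin
        B * (p * (p * p ^ m))                   ≡⟨ alg p b (V ^ m) (p ^ m) ⟩
        4 * (V * (W * (p ^ m * V ^ m)))         ≡⟨ cong (λ u → 4 * (V * (W * u))) (*-^-distrib p V m) ⟨
        4 * M                                   ∎
        where
        open ≡-Reasoning
        alg : ∀ p b v u → 4 * (p * (b * (b * v))) * (p * (p * u)) ≡ 4 * (p * b * (p * (p * b) * (u * v)))
        alg = solve-∀

      p*M : p * M ≡ W ^ k
      p*M = sym (*-assoc p V (W ^ suc m))

      -- At least half of the M edges lie in ℓ classes of at most B = 4 M / p^k edges, so p^k ≤ 8 ℓ;
      -- and 1/ε = d / a ≤ 64 D p.
      colours-needed : ∀ a d n z₀ ℓ → 1 ≤ p → 1 ≤ b → 1 ≤ d → p * (D * a) ≤ d → d ≤ 64 * p * (D * a) →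
        n ≤ 2 * (k * W) → z₀ * d ≤ a * n ^ k → M ≤ z₀ + ℓ * B → d ^ k ≤ ℓ * a ^ k * (8 * (64 * D) ^ k)
      colours-needed a d@(suc _) n z₀ ℓ 1≤p 1≤b _ pDa≤d d≤ n≤ z₀d≤ M≤ = begin
        d ^ k                          ≤⟨ ^-monoˡ-≤ k d≤ ⟩
        (64 * p * (D * a)) ^ k         ≡⟨ cong (_^ k) (alg₃ p D a) ⟩
        (64 * D * (a * p)) ^ k         ≡⟨ *-^-distrib (64 * D) (a * p) k ⟩
        (64 * D) ^ k * (a * p) ^ k     ≡⟨ cong ((64 * D) ^ k *_) (*-^-distrib a p k) ⟩
        (64 * D) ^ k * (a ^ k * p ^ k) ≤⟨ *-monoʳ-≤ ((64 * D) ^ k) (*-monoʳ-≤ (a ^ k) p^k≤) ⟩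
        (64 * D) ^ k * (a ^ k * (8 * ℓ)) ≡⟨ alg₄ ((64 * D) ^ k) (a ^ k) ℓ ⟩
        ℓ * a ^ k * (8 * (64 * D) ^ k) ∎
        where
        open ≤-Reasoning
        instance
          p≢0 : NonZero p
          p≢0 = >-nonZero 1≤p
          b≢0 : NonZero b
          b≢0 = >-nonZero 1≤b
          V≢0 : NonZero V
          V≢0 = m*n≢0 p b
          W≢0 : NonZero W
          W≢0 = m*n≢0 p V
          M≢0 : NonZero M
          M≢0 = m*n≢0 V (W ^ suc m) {{V≢0}} {{m^n≢0 W (suc m)}}
        alg₁ : ∀ a x p M → 2 * (a * (x * (p * M))) ≡ p * (2 * x * a) * M
        alg₁ = solve-∀
        alg₃ : ∀ p D a → 64 * p * (D * a) ≡ 64 * D * (a * p)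
        alg₃ = solve-∀
        alg₄ : ∀ x y ℓ → x * (y * (8 * ℓ)) ≡ ℓ * y * (8 * x)
        alg₄ = solve-∀
        alg₅ : ∀ k W → 2 * (k * W) ≡ 2 * k * W
        alg₅ = solve-∀
        alg₆ : ∀ ℓ B q → 2 * (ℓ * B) * q ≡ 2 * (ℓ * (B * q))
        alg₆ = solve-∀
        alg₇ : ∀ ℓ M → 2 * (ℓ * (4 * M)) ≡ 8 * ℓ * M
        alg₇ = solve-∀
        alg₈ : ∀ z d → 2 * z * d ≡ 2 * (z * d)
        alg₈ = solve-∀
        2z₀≤M : 2 * z₀ ≤ M
        2z₀≤M = *-cancelˡ-≤ d (begin
          d * (2 * z₀)                     ≡⟨ *-comm d (2 * z₀) ⟩
          2 * z₀ * d                       ≡⟨ alg₈ z₀ d ⟩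
          2 * (z₀ * d)                     ≤⟨ *-monoʳ-≤ 2 z₀d≤ ⟩
          2 * (a * n ^ k)                  ≤⟨ *-monoʳ-≤ 2 (*-monoʳ-≤ a (^-monoˡ-≤ k n≤)) ⟩
          2 * (a * (2 * (k * W)) ^ k)      ≡⟨ cong (λ u → 2 * (a * u ^ k)) (alg₅ k W) ⟩
          2 * (a * (2 * k * W) ^ k)        ≡⟨ cong (λ u → 2 * (a * u)) (*-^-distrib (2 * k) W k) ⟩
          2 * (a * ((2 * k) ^ k * W ^ k))  ≡⟨ cong (λ u → 2 * (a * ((2 * k) ^ k * u))) p*M ⟨
          2 * (a * ((2 * k) ^ k * (p * M))) ≡⟨ alg₁ a ((2 * k) ^ k) p M ⟩
          p * (D * a) * M                  ≤⟨ *-monoˡ-≤ M pDa≤d ⟩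
          d * M                            ∎)
        M≤2ℓB : M ≤ 2 * (ℓ * B)
        M≤2ℓB = +-cancelˡ-≤ M _ _ (begin
          M + M                    ≤⟨ +-mono-≤ M≤ M≤ ⟩
          (z₀ + ℓ * B) + (z₀ + ℓ * B) ≡⟨ alg₉ z₀ (ℓ * B) ⟩
          2 * z₀ + 2 * (ℓ * B)     ≤⟨ +-monoˡ-≤ (2 * (ℓ * B)) 2z₀≤M ⟩
          M + 2 * (ℓ * B)          ∎)
          where
          alg₉ : ∀ z x → (z + x) + (z + x) ≡ 2 * z + 2 * x
          alg₉ = solve-∀
        p^k≤ : p ^ k ≤ 8 * ℓ
        p^k≤ = *-cancelʳ-≤ (p ^ k) (8 * ℓ) M (begin
          p ^ k * M               ≡⟨ *-comm (p ^ k) M ⟩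
          M * p ^ k               ≤⟨ *-monoˡ-≤ (p ^ k) M≤2ℓB ⟩
          2 * (ℓ * B) * p ^ k     ≡⟨ alg₆ ℓ B (p ^ k) ⟩
          2 * (ℓ * (B * p ^ k))   ≡⟨ cong (λ u → 2 * (ℓ * u)) B*p^k ⟩
          2 * (ℓ * (4 * M))       ≡⟨ alg₇ ℓ M ⟩
          8 * ℓ * M               ∎)

-- Clearing denominators and the final constants

open import Defs
open import Data.Nat as ℕ using (ℕ; zero; suc; z≤n; s≤s) renaming (_≤_ to _≤ℕ_)
import Data.Nat.Properties as ℕ
open import Data.Nat.Coprimality using (Coprime; 1-coprimeTo) renaming (sym to coprime-sym)
open import Data.Nat.Primality using (Prime; prime⇒nonZero)
open import Data.Integer as ℤ using (+_)
import Data.Integer.Properties as ℤ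
open import Data.Rational using (ℚ; mkℚ; 0ℚ; 1ℚ; _<_; _≤_; _*_; *≤*; *<*; Positive; NonNegative)
open import Data.Rational.Properties as ℚ
  using (toℚᵘ-injective; toℚᵘ-homo-*; ↥p/↧p≡p; *-monoʳ-≤-nonNeg; *-cancelʳ-≤-pos; positive⁻¹; drop-*≤*)
open import Data.Rational.Unnormalised using (mkℚᵘ; *≡*) renaming (_≃_ to _≃ᵘ_)
import Data.Rational.Unnormalised.Properties as ℚᵘ
open import Algebra.Bundles using (CommutativeMonoid)
open import Algebra.Properties.CommutativeSemigroup (CommutativeMonoid.commutativeSemigroup ℚ.*-1-commutativeMonoid) using (interchange; xy∙z≈xz∙y)
open IncidenceHypergraph
open NaturalBounds

-- The normal form of `ℕtoℚ n` with visible numerator and denominator; the quotient (+ n) / 1 itself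
-- passes through a gcd.
integral : ℕ → ℚ
integral n = mkℚ (+ n) 0 (coprime-sym (1-coprimeTo n))

ℕtoℚ≡integral : ∀ n → ℕtoℚ n ≡ integral n
ℕtoℚ≡integral n = ↥p/↧p≡p (integral n)

ℕtoℚ-mono : ∀ {x y} → x ≤ℕ y → ℕtoℚ x ≤ ℕtoℚ y
ℕtoℚ-mono {x} {y} x≤y = subst₂ _≤_ (sym (ℕtoℚ≡integral x)) (sym (ℕtoℚ≡integral y))
  (*≤* (ℤ.*-monoʳ-≤-nonNeg (+ 1) (ℤ.+≤+ x≤y)))

ℕtoℚ-cancel : ∀ {x y} → ℕtoℚ x ≤ ℕtoℚ y → x ≤ℕ y
ℕtoℚ-cancel {x} {y} h = ℤ.drop‿+≤+ (ℤ.*-cancelʳ-≤-pos (+ x) (+ y) (+ 1)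
  (drop-*≤* (subst₂ _≤_ (ℕtoℚ≡integral x) (ℕtoℚ≡integral y) h)))

ℕtoℚ-nonNegative : ∀ n → NonNegative (ℕtoℚ n)
ℕtoℚ-nonNegative n = subst NonNegative (sym (ℕtoℚ≡integral n)) _

ℕtoℚ-positive : ∀ n → .{{ℕ.NonZero n}} → Positive (ℕtoℚ n)
ℕtoℚ-positive (suc n) = subst Positive (sym (ℕtoℚ≡integral (suc n))) _

ℕtoℚ-* : ∀ x y → ℕtoℚ (x ℕ.* y) ≡ ℕtoℚ x * ℕtoℚ y
ℕtoℚ-* x y = trans (ℕtoℚ≡integral (x ℕ.* y))
  (trans (toℚᵘ-injective (ℚᵘ.≃-trans eq (ℚᵘ.≃-sym (toℚᵘ-homo-* (integral x) (integral y)))))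
         (cong₂ _*_ (sym (ℕtoℚ≡integral x)) (sym (ℕtoℚ≡integral y))))
  where
  eq : mkℚᵘ (+ (x ℕ.* y)) 0 ≃ᵘ mkℚᵘ (+ x ℤ.* + y) 0
  eq = *≡* (cong (ℤ._* + 1) (ℤ.pos-* x y))

clear-denominator : ∀ a d-1 .(c : Coprime a (suc d-1)) → mkℚ (+ a) d-1 c * ℕtoℚ (suc d-1) ≡ ℕtoℚ a
clear-denominator a d-1 c = trans (cong (mkℚ (+ a) d-1 c *_) (ℕtoℚ≡integral (suc d-1)))
  (trans (toℚᵘ-injective (ℚᵘ.≃-trans (toℚᵘ-homo-* (mkℚ (+ a) d-1 c) (integral (suc d-1))) eq)) (sym (ℕtoℚ≡integral a)))
  where
  eq : mkℚᵘ (+ a) d-1 Data.Rational.Unnormalised.* mkℚᵘ (+ suc d-1) 0 ≃ᵘ mkℚᵘ (+ a) 0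
  eq = *≡* (trans (ℤ.*-identityʳ (+ a ℤ.* + suc d-1)) (cong (λ u → + a ℤ.* + u) (sym (ℕ.*-identityʳ (suc d-1)))))

clear-power : ∀ {ε a d} → ε * ℕtoℚ d ≡ ℕtoℚ a → ∀ k → (ε ^ℚ k) * ℕtoℚ (d ℕ.^ k) ≡ ℕtoℚ (a ℕ.^ k)
clear-power {ε} {a} {d} eq zero = ℚ.*-identityˡ 1ℚ
clear-power {ε} {a} {d} eq (suc k) = begin
  ε * (ε ^ℚ k) * ℕtoℚ (d ℕ.* d ℕ.^ k)            ≡⟨ cong (ε * (ε ^ℚ k) *_) (ℕtoℚ-* d (d ℕ.^ k)) ⟩
  ε * (ε ^ℚ k) * (ℕtoℚ d * ℕtoℚ (d ℕ.^ k))       ≡⟨ interchange ε (ε ^ℚ k) (ℕtoℚ d) (ℕtoℚ (d ℕ.^ k)) ⟩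
  ε * ℕtoℚ d * ((ε ^ℚ k) * ℕtoℚ (d ℕ.^ k))       ≡⟨ cong₂ _*_ eq (clear-power {ε} {a} {d} eq k) ⟩
  ℕtoℚ a * ℕtoℚ (a ℕ.^ k)                        ≡⟨ ℕtoℚ-* a (a ℕ.^ k) ⟨
  ℕtoℚ (a ℕ.* a ℕ.^ k)                           ∎
  where open ≡-Reasoning

-- This is 1 / q for positive q, the field storing the denominator minus one; at q = 0 the value is
-- 1.
unitFraction : ℕ → ℚ
unitFraction q = mkℚ (+ 1) (ℕ.pred q) (1-coprimeTo _)

clear-unitFraction : ∀ q → .{{ℕ.NonZero q}} → unitFraction q * ℕtoℚ q ≡ 1ℚ
clear-unitFraction (suc q) = clear-denominator 1 q _

scale : ∀ {x y} n → x ≤ y → x * ℕtoℚ n ≤ y * ℕtoℚ n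
scale n = *-monoʳ-≤-nonNeg (ℕtoℚ n) {{ℕtoℚ-nonNegative n}}

module _ {ε : ℚ} {a d : ℕ} (eq : ε * ℕtoℚ d ≡ ℕtoℚ a) where

  private
    scale-ε : ∀ N → ε * ℕtoℚ N * ℕtoℚ d ≡ ℕtoℚ (a ℕ.* N)
    scale-ε N = trans (xy∙z≈xz∙y ε (ℕtoℚ N) (ℕtoℚ d)) (trans (cong (_* ℕtoℚ N) eq) (sym (ℕtoℚ-* a N)))

  ≤-numerators : ∀ {z N} → ℕtoℚ z ≤ ε * ℕtoℚ N → z ℕ.* d ≤ℕ a ℕ.* N
  ≤-numerators {z} {N} h = ℕtoℚ-cancel (subst₂ _≤_ (sym (ℕtoℚ-* z d)) (scale-ε N) (scale d h))

  square-numerators : ∀ {n} → 1ℚ * 1ℚ ≤ ε * ε * ℕtoℚ n → d ℕ.* d ≤ℕ a ℕ.* a ℕ.* n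
  square-numerators {n} h = ℕtoℚ-cancel (subst₂ _≤_
    (trans (cong (_* ℕtoℚ (d ℕ.* d)) (ℚ.*-identityˡ 1ℚ)) (ℚ.*-identityˡ _))
    (begin
      ε * ε * ℕtoℚ n * ℕtoℚ (d ℕ.* d)          ≡⟨ xy∙z≈xz∙y (ε * ε) (ℕtoℚ n) (ℕtoℚ (d ℕ.* d)) ⟩
      ε * ε * ℕtoℚ (d ℕ.* d) * ℕtoℚ n          ≡⟨ cong (λ u → ε * ε * u * ℕtoℚ n) (ℕtoℚ-* d d) ⟩
      ε * ε * (ℕtoℚ d * ℕtoℚ d) * ℕtoℚ n       ≡⟨ cong (_* ℕtoℚ n) (interchange ε ε (ℕtoℚ d) (ℕtoℚ d)) ⟩
      ε * ℕtoℚ d * (ε * ℕtoℚ d) * ℕtoℚ n       ≡⟨ cong (λ u → u * u * ℕtoℚ n) eq ⟩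
      ℕtoℚ a * ℕtoℚ a * ℕtoℚ n                 ≡⟨ cong (_* ℕtoℚ n) (ℕtoℚ-* a a) ⟨
      ℕtoℚ (a ℕ.* a) * ℕtoℚ n                  ≡⟨ ℕtoℚ-* (a ℕ.* a) n ⟨
      ℕtoℚ (a ℕ.* a ℕ.* n)                     ∎)
    (scale (d ℕ.* d) h))
    where open ≡-Reasoning

  small-numerator : ∀ q → .{{ℕ.NonZero q}} → ε ≤ unitFraction q → a ℕ.* q ≤ℕ d
  small-numerator q h = ℕtoℚ-cancel (subst₂ _≤_
    (trans (cong (ε *_) (ℕtoℚ-* d q)) (trans (sym (ℚ.*-assoc ε (ℕtoℚ d) (ℕtoℚ q))) (trans (cong (_* ℕtoℚ q) eq) (sym (ℕtoℚ-* a q)))))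
    (trans (cong (unitFraction q *_) (trans (cong ℕtoℚ (ℕ.*-comm d q)) (ℕtoℚ-* q d)))
      (trans (sym (ℚ.*-assoc (unitFraction q) (ℕtoℚ q) (ℕtoℚ d))) (trans (cong (_* ℕtoℚ d) (clear-unitFraction q)) (ℚ.*-identityˡ (ℕtoℚ d)))))
    (scale (d ℕ.* q) h))

  unitFraction-≤ : ∀ k ℓ q → .{{ℕ.NonZero q}} → .{{ℕ.NonZero d}} → d ℕ.^ k ≤ℕ ℓ ℕ.* a ℕ.^ k ℕ.* q →
                   unitFraction q ≤ ℕtoℚ ℓ * (ε ^ℚ k)
  unitFraction-≤ k ℓ q h = *-cancelʳ-≤-pos (ℕtoℚ (d ℕ.^ k ℕ.* q))
    {{ℕtoℚ-positive _ {{ℕ.m*n≢0 (d ℕ.^ k) q {{ℕ.m^n≢0 d k}}}}}}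
    (subst₂ _≤_ (sym lhs) (sym rhs) (ℕtoℚ-mono h))
    where
    open ≡-Reasoning
    lhs : unitFraction q * ℕtoℚ (d ℕ.^ k ℕ.* q) ≡ ℕtoℚ (d ℕ.^ k)
    lhs = begin
      unitFraction q * ℕtoℚ (d ℕ.^ k ℕ.* q)          ≡⟨ cong (λ u → unitFraction q * ℕtoℚ u) (ℕ.*-comm (d ℕ.^ k) q) ⟩
      unitFraction q * ℕtoℚ (q ℕ.* d ℕ.^ k)          ≡⟨ cong (unitFraction q *_) (ℕtoℚ-* q (d ℕ.^ k)) ⟩
      unitFraction q * (ℕtoℚ q * ℕtoℚ (d ℕ.^ k))     ≡⟨ ℚ.*-assoc (unitFraction q) (ℕtoℚ q) (ℕtoℚ (d ℕ.^ k)) ⟨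
      unitFraction q * ℕtoℚ q * ℕtoℚ (d ℕ.^ k)       ≡⟨ cong (_* ℕtoℚ (d ℕ.^ k)) (clear-unitFraction q) ⟩
      1ℚ * ℕtoℚ (d ℕ.^ k)                            ≡⟨ ℚ.*-identityˡ (ℕtoℚ (d ℕ.^ k)) ⟩
      ℕtoℚ (d ℕ.^ k)                                 ∎
    rhs : ℕtoℚ ℓ * (ε ^ℚ k) * ℕtoℚ (d ℕ.^ k ℕ.* q) ≡ ℕtoℚ (ℓ ℕ.* a ℕ.^ k ℕ.* q)
    rhs = begin
      ℕtoℚ ℓ * (ε ^ℚ k) * ℕtoℚ (d ℕ.^ k ℕ.* q)         ≡⟨ cong (ℕtoℚ ℓ * (ε ^ℚ k) *_) (ℕtoℚ-* (d ℕ.^ k) q) ⟩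
      ℕtoℚ ℓ * (ε ^ℚ k) * (ℕtoℚ (d ℕ.^ k) * ℕtoℚ q)    ≡⟨ ℚ.*-assoc (ℕtoℚ ℓ * (ε ^ℚ k)) (ℕtoℚ (d ℕ.^ k)) (ℕtoℚ q) ⟨
      ℕtoℚ ℓ * (ε ^ℚ k) * ℕtoℚ (d ℕ.^ k) * ℕtoℚ q      ≡⟨ cong (_* ℕtoℚ q) (ℚ.*-assoc (ℕtoℚ ℓ) (ε ^ℚ k) (ℕtoℚ (d ℕ.^ k))) ⟩
      ℕtoℚ ℓ * ((ε ^ℚ k) * ℕtoℚ (d ℕ.^ k)) * ℕtoℚ q    ≡⟨ cong (λ u → ℕtoℚ ℓ * u * ℕtoℚ q) (clear-power {ε} {a} {d} eq k) ⟩
      ℕtoℚ ℓ * ℕtoℚ (a ℕ.^ k) * ℕtoℚ q                 ≡⟨ cong (_* ℕtoℚ q) (ℕtoℚ-* ℓ (a ℕ.^ k)) ⟨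
      ℕtoℚ (ℓ ℕ.* a ℕ.^ k) * ℕtoℚ q                    ≡⟨ ℕtoℚ-* (ℓ ℕ.* a ℕ.^ k) q ⟨
      ℕtoℚ (ℓ ℕ.* a ℕ.^ k ℕ.* q)                       ∎

admissible-bound : ∀ m n a d ε ℓ → .{{ℕ.NonZero d}} → 1 ≤ℕ a → ε * ℕtoℚ d ≡ ℕtoℚ a →
  d ℕ.* d ≤ℕ a ℕ.* a ℕ.* n → a ℕ.* (256 ℕ.* Arithmetic.D m) ≤ℕ d → Admissible (suc (suc m)) n ε 3 ℓ →
  d ℕ.^ suc (suc m) ≤ℕ ℓ ℕ.* a ℕ.^ suc (suc m) ℕ.* (8 ℕ.* (64 ℕ.* Arithmetic.D m) ℕ.^ suc (suc m))
admissible-bound m n a d@(suc _) ε ℓ 1≤a ε≡ d²≤ a≤ adm = conclude (prime-near-quotient (D ℕ.* a) d big)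
  where
  open Arithmetic m
  instance
    a≢0 : ℕ.NonZero a
    a≢0 = ℕ.>-nonZero 1≤a
    Da≢0 : ℕ.NonZero (D ℕ.* a)
    Da≢0 = ℕ.m*n≢0 D a
  big : 256 ℕ.* (D ℕ.* a) ≤ℕ d
  big = subst (_≤ℕ d) (trans (ℕ.*-comm a (256 ℕ.* D)) (ℕ.*-assoc 256 D a)) a≤
  conclude : ∃[ p ] (Prime p × p ℕ.* (D ℕ.* a) ≤ℕ d × d ≤ℕ 64 ℕ.* p ℕ.* (D ℕ.* a)) →
             d ℕ.^ k ≤ℕ ℓ ℕ.* a ℕ.^ k ℕ.* (8 ℕ.* (64 ℕ.* D) ℕ.^ k)
  conclude (p , pr , upper , lower) =
    let b , 1≤b , fit , n≤ = blocks (k ℕ.* (p ℕ.* p)) n {{K≢0}} (room p a d n 1≤a upper d²≤)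
        module Con = Construction pr b m n (ℕ.≤-trans (ℕ.≤-reflexive (rearrange b)) fit)
        col , E₀≤ , diam = adm Con.G
    in Count.colours-needed p b a d n (sizeE₀ Con.G col) ℓ (ℕ.>-nonZero⁻¹ p) 1≤b (s≤s z≤n) upper lower
         (ℕ.≤-trans n≤ (ℕ.≤-reflexive (cong (2 ℕ.*_) (sym (rearrange b)))))
         (≤-numerators {ε} {a} {d} ε≡ {sizeE₀ Con.G col} {n ℕ.^ k} E₀≤) (Con.partition-bound col diam)
    where
    instance
      p≢0 : ℕ.NonZero p
      p≢0 = prime⇒nonZero pr
      K≢0 : ℕ.NonZero (k ℕ.* (p ℕ.* p))
      K≢0 = ℕ.m*n≢0 k (p ℕ.* p) {{_}} {{ℕ.m*n≢0 p p}}
    rearrange : ∀ b → k ℕ.* (p ℕ.* (p ℕ.* b)) ≡ b ℕ.* (k ℕ.* (p ℕ.* p))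
    rearrange b = begin
      k ℕ.* (p ℕ.* (p ℕ.* b))  ≡⟨ cong (k ℕ.*_) (ℕ.*-assoc p p b) ⟨
      k ℕ.* (p ℕ.* p ℕ.* b)    ≡⟨ ℕ.*-assoc k (p ℕ.* p) b ⟨
      k ℕ.* (p ℕ.* p) ℕ.* b    ≡⟨ ℕ.*-comm (k ℕ.* (p ℕ.* p)) b ⟩
      b ℕ.* (k ℕ.* (p ℕ.* p))  ∎
      where open ≡-Reasoning

theorem4p3 : ∀ (k : ℕ) → 2 ≤ℕ k →
    ∃[ c ] ∃[ C ] ∃[ C′ ] (0ℚ < c × 0ℚ < C × 0ℚ < C′ ×
    (∀ (n : ℕ) (ε : ℚ) → 0ℚ < ε → C′ * C′ ≤ ε * ε * ℕtoℚ n → ε ≤ C →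
    ∀ (ℓ : ℕ) → Admissible k n ε 3 ℓ → c ≤ ℕtoℚ ℓ * (ε ^ℚ k)))
theorem4p3 (suc (suc m)) (s≤s (s≤s _)) =
  -- c = 1/q combines p^k ≤ 8 ℓ with 1/ε ≤ 64 D p. C = 1/(256 D) makes 1/(ε D) at least 256, as the
  -- choice of the prime requires. C′ = 1 suffices since D ≥ k absorbs the number of parts.
  unitFraction q , unitFraction (256 ℕ.* D) , 1ℚ , positive⁻¹ _ , positive⁻¹ _ , positive⁻¹ _ , bound
  where
  open Arithmetic m
  q = 8 ℕ.* (64 ℕ.* D) ℕ.^ k
  instance
    64D≢0 : ℕ.NonZero (64 ℕ.* D)
    64D≢0 = ℕ.m*n≢0 64 D
    q≢0 : ℕ.NonZero q
    q≢0 = ℕ.m*n≢0 8 ((64 ℕ.* D) ℕ.^ k) {{_}} {{ℕ.m^n≢0 (64 ℕ.* D) k}}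
    256D≢0 : ℕ.NonZero (256 ℕ.* D)
    256D≢0 = ℕ.m*n≢0 256 D
  bound : ∀ (n : ℕ) (ε : ℚ) → 0ℚ < ε → 1ℚ * 1ℚ ≤ ε * ε * ℕtoℚ n → ε ≤ unitFraction (256 ℕ.* D) →
          ∀ (ℓ : ℕ) → Admissible k n ε 3 ℓ → unitFraction q ≤ ℕtoℚ ℓ * (ε ^ℚ k)
  bound n (mkℚ (+ zero) d-1 c) (*<* (ℤ.+<+ ()))
  bound n ε@(mkℚ (+ a@(suc _)) d-1 c) _ large small ℓ adm =
    unitFraction-≤ {ε} {a} {suc d-1} ε≡ k ℓ q
      (admissible-bound m n a (suc d-1) ε ℓ (s≤s z≤n) ε≡
        (square-numerators {ε} {a} {suc d-1} ε≡ large)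
        (small-numerator {ε} {a} {suc d-1} ε≡ (256 ℕ.* D) small) adm)
    where
    ε≡ : ε * ℕtoℚ (suc d-1) ≡ ℕtoℚ a
    ε≡ = clear-denominator a d-1 c
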